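{- There is a universal constant $c>0$ such that for all integers $n,k\ge 1$ and every function $f\colon\{0,1\}^n\to\{0,1\}$, $$\mathsf{R}(f^k)\;\ge\; c\cdot k\cdot \mathsf{disc}(f).$$
   Context: Inner products are over $\mathbb{F}_2$: $\langle a,x\rangle=\sum_i a_ix_i \bmod 2$. A deterministic parity decision tree $T$ on $\{0,1\}^N$ is a rooted binary tree in which every internal node is labelled by a vector $a\in\{0,1\}^N$ (the query $\langle a,x\rangle$) and has two children, one for each outcome in $\{0,1\}$, and every leaf is labelled by an output value; $T(x)$ is the label of the leaf reached on input $x$. The depth of $T$ is the maximum number of queries on a root-to-leaf path. A randomised parity decision tree $\mathcal{T}$ is a probability distribution over deterministic ones. For $g\colon\{0,1\}^N\to\{0,1\}^m$, $\mathsf{R}(g)$ is the least $d$ such that some randomised parity decision tree $\mathcal{T}$, supported on trees of depth at most $d$, satisfies $\Pr_{T\sim\mathcal{T}}[T(x)\ne g(x)]\le 1/3$ for every $x$. $f^k\colon(\{0,1\}^n)^k\to\{0,1\}^k$ is $f^k(x^1,\dots,x^k)=(f(x^1),\dots,f(x^k))$. Discrepancy: for a probability distribution $\mu$ on $\{0,1\}^n$ and an affine subspace $S\subseteq\{0,1\}^n=\mathbb{F}_2^n$, let $\mathsf{bias}(f,\mu,S)=\left|\sum_{x\in S}(-1)^{f(x)}\mu(x)\right|$. Let $\mathsf{disc}(f,\mu)=-\log_2\max_{S}\mathsf{bias}(f,\mu,S)$, the maximum over all affine subspaces $S$ of $\{0,1\}^n$, and $\mathsf{disc}(f)=\max_\mu\mathsf{disc}(f,\mu)$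 over all probability distributions $\mu$ on $\{0,1\}^n$. -}

module Defs where

open import Algebra.Bundles using (CommutativeMonoid)
import Algebra.Properties.AbelianGroup as AbelianGroupProperties
import Algebra.Properties.CommutativeSemigroup as CommutativeSemigroupProperties
open import Data.Bool using (Bool; true; false; _∧_; _xor_; if_then_else_)
open import Data.Bool.Properties using () renaming (_≟_ to _≟ᵇ_)
open import Data.Fin using (Fin)
open import Data.Integer as ℤ using (ℤ; +_; -[1+_])
open import Data.List using (List; []; _∷_; _++_; map; foldr; filter; filterᵇ; allFin)
open import Data.Nat as ℕ using (ℕ; zero; suc)
open import Data.Product using (Σ; ∃; ∃-syntax; _×_; proj₁)
open import Data.Rational as ℚ using (ℚ; 0ℚ; 1ℚ; ½; mkℚ; ↥_; ↧ₙ_)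
import Data.Rational.Properties as ℚₚ
open import Data.Vec as Vec using (Vec; []; _∷_)
open import Data.Vec.Properties using (≡-dec)
open import Relation.Binary.PropositionalEquality using (_≡_; refl; sym; trans; cong; cong₂; subst)
open import Relation.Nullary.Decidable using (¬?)

open AbelianGroupProperties ℚₚ.+-0-abelianGroup
  using (⁻¹-anti-homo‿-; //-rightDividesˡ; //-rightDividesʳ)
open CommutativeSemigroupProperties (CommutativeMonoid.commutativeSemigroup ℚₚ.+-0-commutativeMonoid)
  using (interchange)

------------------------------------------------------------------------
-- Powers of rationals

infixr 8 _^_
_^_ : ℚ → ℕ → ℚ
q ^ zero  = 1ℚ
q ^ suc n = q ℚ.* q ^ n

2^_ : ℤ → ℚ
2^ (+ n)    = (+ 2 ℚ./ 1) ^ n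
2^ -[1+ n ] = ½ ^ suc n

------------------------------------------------------------------------
-- Real numbers: Cauchy sequences of rationals converging at rate 2⁻ⁿ,
-- i.e. the n-th term is within 2⁻ⁿ of the number represented.

record ℝ : Set where
  constructor mkℝ
  field
    seq     : ℕ → ℚ
    regular : ∀ m n → ℚ.∣ seq m ℚ.- seq n ∣ ℚ.≤ ½ ^ m ℚ.+ ½ ^ n

open ℝ public

fromℚ : ℚ → ℝ
fromℚ q = mkℝ (λ _ → q) reg
  where
  abstract
    ½^-nonNeg : ∀ n → 0ℚ ℚ.≤ ½ ^ n
    ½^-nonNeg zero    = ℚₚ.nonNegative⁻¹ 1ℚ
    ½^-nonNeg (suc n) = subst (ℚ._≤ ½ ^ suc n) (ℚₚ.*-zeroʳ ½) (ℚₚ.*-monoˡ-≤-nonNeg ½ (½^-nonNeg n))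

    reg : ∀ m n → ℚ.∣ q ℚ.- q ∣ ℚ.≤ ½ ^ m ℚ.+ ½ ^ n
    reg m n = subst (ℚ._≤ ½ ^ m ℚ.+ ½ ^ n) (sym (cong ℚ.∣_∣ (ℚₚ.+-inverseʳ q)))
                    (ℚₚ.+-mono-≤ (½^-nonNeg m) (½^-nonNeg n))

0ℝ 1ℝ : ℝ
0ℝ = fromℚ 0ℚ
1ℝ = fromℚ 1ℚ

infixl 6 _+ʳ_
_+ʳ_ : ℝ → ℝ → ℝ
x +ʳ y = mkℝ (λ n → seq x (suc n) ℚ.+ seq y (suc n)) reg
  where
  abstract
    swap : ∀ a b c d → (a ℚ.+ b) ℚ.- (c ℚ.+ d) ≡ (a ℚ.- c) ℚ.+ (b ℚ.- d)
    swap a b c d = trans (cong (a ℚ.+ b ℚ.+_) (ℚₚ.neg-distrib-+ c d)) (interchange a b (ℚ.- c) (ℚ.- d))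

    halve : ∀ a → ½ ℚ.* a ℚ.+ ½ ℚ.* a ≡ a
    halve a = trans (sym (ℚₚ.*-distribʳ-+ a ½ ½)) (ℚₚ.*-identityˡ a)

    halves : ∀ a b → (½ ℚ.* a ℚ.+ ½ ℚ.* b) ℚ.+ (½ ℚ.* a ℚ.+ ½ ℚ.* b) ≡ a ℚ.+ b
    halves a b = trans (interchange (½ ℚ.* a) (½ ℚ.* b) (½ ℚ.* a) (½ ℚ.* b)) (cong₂ ℚ._+_ (halve a) (halve b))

    reg : ∀ m n → ℚ.∣ (seq x (suc m) ℚ.+ seq y (suc m)) ℚ.- (seq x (suc n) ℚ.+ seq y (suc n)) ∣
                  ℚ.≤ ½ ^ m ℚ.+ ½ ^ n
    reg m n = begin
      ℚ.∣ (a ℚ.+ b) ℚ.- (c ℚ.+ d) ∣ ≡⟨ cong ℚ.∣_∣ (swap a b c d) ⟩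
      ℚ.∣ (a ℚ.- c) ℚ.+ (b ℚ.- d) ∣ ≤⟨ ℚₚ.∣p+q∣≤∣p∣+∣q∣ (a ℚ.- c) (b ℚ.- d) ⟩
      ℚ.∣ a ℚ.- c ∣ ℚ.+ ℚ.∣ b ℚ.- d ∣ ≤⟨ ℚₚ.+-mono-≤ (regular x (suc m) (suc n)) (regular y (suc m) (suc n)) ⟩
      (½ ^ suc m ℚ.+ ½ ^ suc n) ℚ.+ (½ ^ suc m ℚ.+ ½ ^ suc n) ≡⟨ halves (½ ^ m) (½ ^ n) ⟩
      ½ ^ m ℚ.+ ½ ^ n ∎
      where
      open ℚₚ.≤-Reasoning
      a b c d : ℚ
      a = seq x (suc m)
      b = seq y (suc m)
      c = seq x (suc n)
      d = seq y (suc n)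

-ʳ_ : ℝ → ℝ
-ʳ x = mkℝ (λ n → ℚ.- seq x n) reg
  where
  abstract
    flip-sign : ∀ a b → (ℚ.- a) ℚ.- (ℚ.- b) ≡ ℚ.- (a ℚ.- b)
    flip-sign a b = sym (ℚₚ.neg-distrib-+ a (ℚ.- b))

    reg : ∀ m n → ℚ.∣ (ℚ.- seq x m) ℚ.- (ℚ.- seq x n) ∣ ℚ.≤ ½ ^ m ℚ.+ ½ ^ n
    reg m n = subst (ℚ._≤ ½ ^ m ℚ.+ ½ ^ n)
      (sym (trans (cong ℚ.∣_∣ (flip-sign (seq x m) (seq x n))) (ℚₚ.∣-p∣≡∣p∣ (seq x m ℚ.- seq x n))))
      (regular x m n)

∣_∣ʳ : ℝ → ℝ
∣ x ∣ʳ = mkℝ (λ n → ℚ.∣ seq x n ∣) reg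
  where
  abstract
    ∣a∣≤ : ∀ a b → ℚ.∣ a ∣ ℚ.≤ ℚ.∣ a ℚ.- b ∣ ℚ.+ ℚ.∣ b ∣
    ∣a∣≤ a b = subst (λ z → ℚ.∣ z ∣ ℚ.≤ ℚ.∣ a ℚ.- b ∣ ℚ.+ ℚ.∣ b ∣)
      (//-rightDividesˡ b a) (ℚₚ.∣p+q∣≤∣p∣+∣q∣ (a ℚ.- b) b)

    diff≤ : ∀ a b → ℚ.∣ a ∣ ℚ.- ℚ.∣ b ∣ ℚ.≤ ℚ.∣ a ℚ.- b ∣
    diff≤ a b = subst (ℚ.∣ a ∣ ℚ.- ℚ.∣ b ∣ ℚ.≤_)
      (//-rightDividesʳ ℚ.∣ b ∣ ℚ.∣ a ℚ.- b ∣)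
      (ℚₚ.+-monoˡ-≤ (ℚ.- ℚ.∣ b ∣) (∣a∣≤ a b))

    neg-diff : ∀ a b → ℚ.- (a ℚ.- b) ≡ b ℚ.- a
    neg-diff = ⁻¹-anti-homo‿-

    ∣-∣-sym : ∀ a b → ℚ.∣ b ℚ.- a ∣ ≡ ℚ.∣ a ℚ.- b ∣
    ∣-∣-sym a b = trans (cong ℚ.∣_∣ (sym (neg-diff a b))) (ℚₚ.∣-p∣≡∣p∣ (a ℚ.- b))

    ∣∣-bound : ∀ {p r} → p ℚ.≤ r → ℚ.- p ℚ.≤ r → ℚ.∣ p ∣ ℚ.≤ r
    ∣∣-bound {mkℚ (+ _)    _ _} p≤r _ = p≤r
    ∣∣-bound {mkℚ -[1+ _ ] _ _} _ -p≤r = -p≤r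

    ∣∣a∣-∣b∣∣≤∣a-b∣ : ∀ a b → ℚ.∣ ℚ.∣ a ∣ ℚ.- ℚ.∣ b ∣ ∣ ℚ.≤ ℚ.∣ a ℚ.- b ∣
    ∣∣a∣-∣b∣∣≤∣a-b∣ a b = ∣∣-bound (diff≤ a b)
      (subst (ℚ._≤ ℚ.∣ a ℚ.- b ∣) (sym (neg-diff ℚ.∣ a ∣ ℚ.∣ b ∣))
        (subst (ℚ.∣ b ∣ ℚ.- ℚ.∣ a ∣ ℚ.≤_) (∣-∣-sym a b) (diff≤ b a)))

    reg : ∀ m n → ℚ.∣ ℚ.∣ seq x m ∣ ℚ.- ℚ.∣ seq x n ∣ ∣ ℚ.≤ ½ ^ m ℚ.+ ½ ^ n
    reg m n = ℚₚ.≤-trans (∣∣a∣-∣b∣∣≤∣a-b∣ (seq x m) (seq x n)) (regular x m n)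

infix 4 _≤ʳ_ _<ʳ_ _≃ʳ_

_≤ʳ_ _<ʳ_ _≃ʳ_ : ℝ → ℝ → Set
x ≤ʳ y = ∀ n → seq x n ℚ.≤ seq y n ℚ.+ (½ ^ n ℚ.+ ½ ^ n)
x <ʳ y = ∃[ n ] seq x n ℚ.+ (½ ^ n ℚ.+ ½ ^ n) ℚ.< seq y n
x ≃ʳ y = x ≤ʳ y × y ≤ʳ x

∑ : {A : Set} → List A → (A → ℝ) → ℝ
∑ xs w = foldr (λ a s → w a +ʳ s) 0ℝ xs

-- For an inhabited finite family the least upper bound is the maximum.  The
-- second field does not name one maximising index because order on ℝ is
-- undecidable.
record IsMax {I : Set} (P : I → Set) (v : I → ℝ) (M : ℝ) : Set where
  field
    upper : ∀ i → P i → v i ≤ʳ M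
    least : ∀ r → r <ʳ M → ∃[ i ] P i × r <ʳ v i

------------------------------------------------------------------------
-- A quantity given by the rationals strictly below it.  Suprema and infima
-- such as disc and 𝖱 below need no more than this.

LowerReal : Set₁
LowerReal = ℚ → Set

infix 4 _≤ᴸ_
_≤ᴸ_ : LowerReal → LowerReal → Set
a ≤ᴸ b = ∀ q → a q → b q

-- Multiplication by a positive rational
infixr 7 _·_
_·_ : ℚ → LowerReal → LowerReal
(c · a) q = ∃[ p ] a p × q ℚ.≤ c ℚ.* p

-- For x > 0.  q < -log₂ x means x < 2^(-q), i.e. x < t for some rational
-- t ≤ 2^(-q); with q = u / v this reads t^v ≤ 2^(-u).
−log₂_ : ℝ → LowerReal
(−log₂ x) q = ∃[ t ] x <ʳ fromℚ t × t ^ (↧ₙ q) ℚ.≤ 2^ (ℤ.- (↥ q))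

------------------------------------------------------------------------
-- The cube {0,1}ⁿ = 𝔽₂ⁿ

Cube : ℕ → Set
Cube n = Vec Bool n

cube : ∀ n → List (Cube n)
cube zero    = [] ∷ []
cube (suc n) = map (false ∷_) (cube n) ++ map (true ∷_) (cube n)

infixl 6 _⊕_
_⊕_ : ∀ {n} → Cube n → Cube n → Cube n
_⊕_ = Vec.zipWith _xor_

⟨_,_⟩ : ∀ {n} → Cube n → Cube n → Bool
⟨ a , x ⟩ = Vec.foldr′ _xor_ false (Vec.zipWith _∧_ a x)

IsLinearSubspace : ∀ {n} → (Cube n → Bool) → Set
IsLinearSubspace {n} V =
  V (Vec.replicate n false) ≡ true × (∀ x y → V x ≡ true → V y ≡ true → V (x ⊕ y) ≡ true)

-- S = p + V; over 𝔽₂, x ∈ p + V iff x + p ∈ V.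
IsAffineSubspace : ∀ {n} → (Cube n → Bool) → Set
IsAffineSubspace S = ∃[ p ] ∃[ V ] IsLinearSubspace V × (∀ x → S x ≡ V (x ⊕ p))

------------------------------------------------------------------------
-- Discrepancy

record Distribution (n : ℕ) : Set where
  field
    mass   : Cube n → ℝ
    nonNeg : ∀ x → 0ℝ ≤ʳ mass x
    total  : ∑ (cube n) mass ≃ʳ 1ℝ

open Distribution public

bias : ∀ {n} → (Cube n → Bool) → Distribution n → (Cube n → Bool) → ℝ
bias {n} f μ S = ∣ ∑ (filterᵇ S (cube n)) (λ x → if f x then -ʳ mass μ x else mass μ x) ∣ʳ

discFor : ∀ {n} → (Cube n → Bool) → Distribution n → LowerReal
discFor f μ q = ∃[ M ] IsMax IsAffineSubspace (bias f μ) M × (−log₂ M) q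

disc : ∀ {n} → (Cube n → Bool) → LowerReal
disc {n} f q = Σ (Distribution n) λ μ → discFor f μ q

------------------------------------------------------------------------
-- Parity decision trees

data PDT (N : ℕ) (A : Set) : Set where
  leaf  : A → PDT N A
  query : Cube N → (Bool → PDT N A) → PDT N A

run : ∀ {N A} → PDT N A → Cube N → A
run (leaf v)    x = v
run (query a T) x = run (T ⟨ a , x ⟩) x

depth : ∀ {N A} → PDT N A → ℕ
depth (leaf v)    = 0
depth (query a T) = suc (depth (T false) ℕ.⊔ depth (T true))

-- There are finitely many trees of depth at most d with labels in {0,1}ᵐ, so
-- every distribution on them is a finite family of weighted trees.
record RandomisedPDT (N m d : ℕ) : Set where
  field
    size    : ℕ
    tree    : Fin size → PDT N (Cube m)
    weight  : Fin size → ℝ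
    bounded : ∀ i → depth (tree i) ℕ.≤ d
    nonNeg  : ∀ i → 0ℝ ≤ʳ weight i
    total   : ∑ (allFin size) weight ≃ʳ 1ℝ

  errorAt : (Cube N → Cube m) → Cube N → ℝ
  errorAt g x = ∑ (filter (λ i → ¬? (≡-dec _≟ᵇ_ (run (tree i) x) (g x))) (allFin size)) weight

Computable : ∀ {N m} → (Cube N → Cube m) → ℕ → Set
Computable {N} {m} g d =
  Σ (RandomisedPDT N m d) λ 𝒯 → ∀ x → RandomisedPDT.errorAt 𝒯 g x ≤ʳ fromℚ (+ 1 ℚ./ 3)

-- The least d with Computable g d: q lies below it iff q lies below every such d.
𝖱 : ∀ {N m} → (Cube N → Cube m) → LowerReal
𝖱 g q = ∀ d → Computable g d → q ℚ.< + d ℚ./ 1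

-- ({0,1}ⁿ)ᵏ is identified with {0,1}^(k n) by concatenating the k blocks.
infixl 8 _^ᵏ_
_^ᵏ_ : ∀ {n} → (Cube n → Bool) → (k : ℕ) → Cube (k ℕ.* n) → Cube k
_^ᵏ_ {n} f k x = Vec.map f (proj₁ (Vec.group k n x))

{-# OPTIONS --safe #-}
-- Two lower bounds on the depth d of a randomised tree for fᵏ are combined, both obtained by feeding it a product
-- distribution m^⊗k and measuring a product payoff ∏ ψ(f xⁱ, vⁱ) of its output v.  The Fourier coefficients of the
-- payoff with v fixed factorise over the blocks, so they are at most Bᵏ if those of x ↦ m(x) ψ(f x, b) are at most B.
-- A parity query splits a function along 1[⟨b,x⟩ = c] = (1 ± χ b) / 2, which only shifts frequencies and hence at
-- most doubles the largest coefficient; so the expected payoff is at most 2ᵈ Bᵏ.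
--
-- With m uniform on one 0-input and one 1-input of a nonconstant f and ψ the equality test, this gives k ≤ d.  With
-- m = μ and ψ(b, c) = (-1)^(b + c) it gives 1/5 ≤ 2ᵈ (3t)ᵏ whenever every affine bias of f under μ is below t, since
-- χ a = 2·1[⟨a,x⟩ = 0] - 1.  For t = 2⁻ᵖ the latter reads p k ≤ d + 3 + 2k, hence p k ≤ 6d.
module Submission where

open import Defs
open import Algebra.Bundles using (module CommutativeMonoid; module CommutativeRing)
import Algebra.Properties.CommutativeSemigroup as CommutativeSemigroupProperties
open import Data.Bool using (Bool; true; false; _∧_; _xor_; if_then_else_; not; T?)
open import Data.Bool.Properties
  using (∧-comm; ∧-distribʳ-xor; xor-assoc; xor-identityʳ; xor-same; xor-∧-commutativeRing)
  renaming (_≟_ to _≟ᵇ_)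
open import Data.Empty using (⊥; ⊥-elim)
open import Data.Fin using (Fin)
import Data.Integer as ℤ
import Data.Integer.Properties as ℤₚ
open import Data.List using (List; []; _∷_; _++_; map; filter; filterᵇ; allFin)
open import Data.Nat as ℕ using (ℕ; zero; suc; NonZero)
open import Data.Nat.Coprimality using (Coprime)
import Data.Nat.Properties as ℕₚ
open import Data.Nat.Tactic.RingSolver using (solve-∀)
open import Data.Product using (_,_; proj₁; proj₂; _×_; ∃-syntax)
open import Data.Rational hiding (NonZero)
open import Data.Rational.Properties
open import Data.Rational.Solver
import Data.Rational.Unnormalised as ℚᵘ
import Data.Rational.Unnormalised.Properties as ℚᵘₚ
open import Data.Sum using (_⊎_; inj₁; inj₂)
open import Data.Vec as Vec using (Vec; []; _∷_)
open import Data.Vec.Properties using (≡-dec; ++-injective; take++drop≡id; zipWith-identityʳ)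
open import Function using (_∘_)
open import Relation.Binary.PropositionalEquality
import Relation.Binary.Reasoning.Setoid as SetoidReasoning
open import Relation.Nullary.Decidable using (Dec; yes; no; ¬?; does)
open import Relation.Unary using (Decidable)
open +-*-Solver using (solve; _:+_; _:*_; _:-_; :-_; _:=_; con)
open CommutativeSemigroupProperties
  (CommutativeMonoid.commutativeSemigroup (CommutativeRing.+-commutativeMonoid xor-∧-commutativeRing))
  using () renaming (interchange to xor-interchange)

private variable
  A C : Set
  d k n : ℕ
  p q t ε δ : ℚ
  x y : ℝ

-- Ordered arithmetic and powers of rationals

2ℚ : ℚ
2ℚ = ℤ.+ 2 / 1

≤⇒≯ : p ≤ q → q < p → ⊥
≤⇒≯ p≤q q<p = <-irrefl refl (<-≤-trans q<p p≤q)

≤-gap : ∀ {p q} d → 0ℚ ≤ d → p + d ≡ q → p ≤ q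
≤-gap {p} {q} d 0≤d refl = subst (_≤ p + d) (+-identityʳ p) (+-monoʳ-≤ p 0≤d)

0≤p+q : ∀ {p q} → 0ℚ ≤ p → 0ℚ ≤ q → 0ℚ ≤ p + q
0≤p+q = +-mono-≤

*-monoˡ-≤ : ∀ {r p q} → 0ℚ ≤ r → p ≤ q → r * p ≤ r * q
*-monoˡ-≤ {r} 0≤r p≤q = *-monoˡ-≤-nonNeg r {{nonNegative 0≤r}} p≤q

*-monoʳ-≤ : ∀ {r p q} → 0ℚ ≤ r → p ≤ q → p * r ≤ q * r
*-monoʳ-≤ {r} 0≤r p≤q = *-monoʳ-≤-nonNeg r {{nonNegative 0≤r}} p≤q

*-mono-≤ : ∀ {p q r s} → 0ℚ ≤ r → 0ℚ ≤ q → p ≤ q → r ≤ s → p * r ≤ q * s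
*-mono-≤ 0≤r 0≤q p≤q r≤s = ≤-trans (*-monoʳ-≤ 0≤r p≤q) (*-monoˡ-≤ 0≤q r≤s)

0≤p*q : ∀ {p q} → 0ℚ ≤ p → 0ℚ ≤ q → 0ℚ ≤ p * q
0≤p*q {p} {q} 0≤p 0≤q = subst (_≤ p * q) (*-zeroʳ p) (*-monoˡ-≤ 0≤p 0≤q)

0<p*q : ∀ {p q} → 0ℚ < p → 0ℚ < q → 0ℚ < p * q
0<p*q {p} {q} 0<p 0<q = subst (_< p * q) (*-zeroʳ p) (*-monoʳ-<-pos p {{positive 0<p}} 0<q)

*-cancelˡ-≤ : ∀ {r p q} → 0ℚ < r → r * p ≤ r * q → p ≤ q
*-cancelˡ-≤ {r} 0<r = *-cancelˡ-≤-pos r {{positive 0<r}}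

+-cancelʳ-< : ∀ r {p q} → p + r < q + r → p < q
+-cancelʳ-< r {p} {q} lt = subst₂ _<_ (cancel p) (cancel q) (+-monoˡ-< (- r) lt)
  where
  cancel : ∀ x → x + r - r ≡ x
  cancel x = solve 2 (λ x r → x :+ r :- r := x) refl x r

p≤∣p∣ : ∀ p → p ≤ ∣ p ∣
p≤∣p∣ p with ≤-total 0ℚ p
... | inj₁ 0≤p = ≤-reflexive (sym (0≤p⇒∣p∣≡p 0≤p))
... | inj₂ p≤0 = ≤-trans p≤0 (0≤∣p∣ p)

-p≤∣p∣ : ∀ p → - p ≤ ∣ p ∣
-p≤∣p∣ p = subst (- p ≤_) (∣-p∣≡∣p∣ p) (p≤∣p∣ (- p))

∣p∣≤ : ∀ {p b} → p ≤ b → - p ≤ b → ∣ p ∣ ≤ b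
∣p∣≤ {p} p≤b -p≤b with ∣p∣≡p∨∣p∣≡-p p
... | inj₁ eq = subst (_≤ _) (sym eq) p≤b
... | inj₂ eq = subst (_≤ _) (sym eq) -p≤b

∣p*q∣≤ : ∀ {p q b c} → ∣ p ∣ ≤ b → ∣ q ∣ ≤ c → ∣ p * q ∣ ≤ b * c
∣p*q∣≤ {p} {q} {b} {c} p≤b q≤c = subst (_≤ b * c) (sym (∣p*q∣≡∣p∣*∣q∣ p q))
  (*-mono-≤ (0≤∣p∣ q) (≤-trans (0≤∣p∣ p) p≤b) p≤b q≤c)

0≤p^n : ∀ {p} n → 0ℚ ≤ p → 0ℚ ≤ p ^ n
0≤p^n zero    _   = nonNegative⁻¹ 1ℚ
0≤p^n (suc n) 0≤p = 0≤p*q 0≤p (0≤p^n n 0≤p)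

0<p^n : ∀ {p} n → 0ℚ < p → 0ℚ < p ^ n
0<p^n zero    _   = positive⁻¹ 1ℚ
0<p^n (suc n) 0<p = 0<p*q 0<p (0<p^n n 0<p)

^-monoˡ-≤ : ∀ {p q} n → 0ℚ ≤ p → p ≤ q → p ^ n ≤ q ^ n
^-monoˡ-≤ zero    _   _   = ≤-refl
^-monoˡ-≤ (suc n) 0≤p p≤q = *-mono-≤ (0≤p^n n 0≤p) (≤-trans 0≤p p≤q) p≤q (^-monoˡ-≤ n 0≤p p≤q)

1^n≡1 : ∀ n → 1ℚ ^ n ≡ 1ℚ
1^n≡1 zero    = refl
1^n≡1 (suc n) = trans (*-identityˡ (1ℚ ^ n)) (1^n≡1 n)

1≤p^n : ∀ {p} n → 1ℚ ≤ p → 1ℚ ≤ p ^ n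
1≤p^n {p} n 1≤p = subst (_≤ p ^ n) (1^n≡1 n) (^-monoˡ-≤ n (nonNegative⁻¹ 1ℚ) 1≤p)

^-distribˡ-+-* : ∀ p m n → p ^ (m ℕ.+ n) ≡ p ^ m * p ^ n
^-distribˡ-+-* p zero    n = sym (*-identityˡ (p ^ n))
^-distribˡ-+-* p (suc m) n = trans (cong (p *_) (^-distribˡ-+-* p m n)) (sym (*-assoc p (p ^ m) (p ^ n)))

^-distribʳ-* : ∀ p q n → (p * q) ^ n ≡ p ^ n * q ^ n
^-distribʳ-* p q zero    = refl
^-distribʳ-* p q (suc n) = trans (cong (p * q *_) (^-distribʳ-* p q n))
  (solve 4 (λ a b c d → a :* b :* (c :* d) := a :* c :* (b :* d)) refl p q (p ^ n) (q ^ n))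

^-*-assoc : ∀ p m n → (p ^ m) ^ n ≡ p ^ (n ℕ.* m)
^-*-assoc p m zero    = refl
^-*-assoc p m (suc n) = trans (cong (p ^ m *_) (^-*-assoc p m n)) (sym (^-distribˡ-+-* p m (n ℕ.* m)))

2^-mono : ∀ {i j} → i ℕ.≤ j → 2ℚ ^ i ≤ 2ℚ ^ j
2^-mono {i} {j} i≤j = subst (2ℚ ^ i ≤_)
  (trans (sym (^-distribˡ-+-* 2ℚ i (j ℕ.∸ i))) (cong (2ℚ ^_) (ℕₚ.m+[n∸m]≡n i≤j)))
  (subst (_≤ 2ℚ ^ i * 2ℚ ^ (j ℕ.∸ i)) (*-identityʳ (2ℚ ^ i))
    (*-monoˡ-≤ (0≤p^n i (nonNegative⁻¹ 2ℚ)) (1≤p^n (j ℕ.∸ i) (≤ᵇ⇒≤ _))))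

2^-cancel-≤ : ∀ i j → 2ℚ ^ i ≤ 2ℚ ^ j → i ℕ.≤ j
2^-cancel-≤ i j le with i ℕ.≤? j
... | yes i≤j = i≤j
... | no  i≰j = ⊥-elim (≤⇒≯ (≤-trans (2^-mono (ℕₚ.≰⇒> i≰j)) le)
  (subst (_< 2ℚ * 2ℚ ^ j) (*-identityˡ (2ℚ ^ j)) (*-monoˡ-<-pos (2ℚ ^ j) {{positive (0<p^n j (positive⁻¹ 2ℚ))}} 1<2)))
  where
  1<2 : 1ℚ < 2ℚ
  1<2 = *<* (ℤ.+<+ (ℕ.s≤s (ℕ.s≤s ℕ.z≤n)))

2^-neg : ∀ u → 2^ (ℤ.- (ℤ.+ u)) ≡ ½ ^ u
2^-neg zero    = refl
2^-neg (suc u) = refl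

-- Finite sums

sum : List A → (A → ℚ) → ℚ
sum []       g = 0ℚ
sum (a ∷ as) g = g a + sum as g

sum-cong : ∀ (xs : List A) {g h} → (∀ a → g a ≡ h a) → sum xs g ≡ sum xs h
sum-cong []       eq = refl
sum-cong (a ∷ as) eq = cong₂ _+_ (eq a) (sum-cong as eq)

sum-mono : ∀ (xs : List A) {g h} → (∀ a → g a ≤ h a) → sum xs g ≤ sum xs h
sum-mono []       le = ≤-refl
sum-mono (a ∷ as) le = +-mono-≤ (le a) (sum-mono as le)

sum-zero : ∀ (xs : List A) → sum xs (λ _ → 0ℚ) ≡ 0ℚ
sum-zero []       = refl
sum-zero (a ∷ as) = trans (+-identityˡ _) (sum-zero as)

sum-+ : ∀ (xs : List A) g h → sum xs (λ a → g a + h a) ≡ sum xs g + sum xs h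
sum-+ []       g h = refl
sum-+ (a ∷ as) g h = trans (cong (g a + h a +_) (sum-+ as g h))
  (solve 4 (λ p q r s → (p :+ q) :+ (r :+ s) := (p :+ r) :+ (q :+ s)) refl (g a) (h a) (sum as g) (sum as h))

sum-*ˡ : ∀ (xs : List A) c g → sum xs (λ a → c * g a) ≡ c * sum xs g
sum-*ˡ []       c g = sym (*-zeroʳ c)
sum-*ˡ (a ∷ as) c g = trans (cong (c * g a +_) (sum-*ˡ as c g)) (sym (*-distribˡ-+ c (g a) (sum as g)))

sum-*ʳ : ∀ (xs : List A) c g → sum xs (λ a → g a * c) ≡ sum xs g * c
sum-*ʳ xs c g = trans (sum-cong xs (λ a → *-comm (g a) c)) (trans (sum-*ˡ xs c g) (*-comm c _))

sum-neg : ∀ (xs : List A) g → sum xs (λ a → - g a) ≡ - sum xs g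
sum-neg []       g = refl
sum-neg (a ∷ as) g = trans (cong (- g a +_) (sum-neg as g)) (sym (neg-distrib-+ (g a) (sum as g)))

sum-++ : ∀ (xs ys : List A) g → sum (xs ++ ys) g ≡ sum xs g + sum ys g
sum-++ []       ys g = sym (+-identityˡ _)
sum-++ (a ∷ as) ys g = trans (cong (g a +_) (sum-++ as ys g)) (sym (+-assoc (g a) _ _))

sum-map : ∀ (φ : C → A) xs g → sum (map φ xs) g ≡ sum xs (λ c → g (φ c))
sum-map φ []       g = refl
sum-map φ (x ∷ xs) g = cong (g (φ x) +_) (sum-map φ xs g)

sum-swap : ∀ (xs : List A) (ys : List C) (g : A → C → ℚ) →
           sum xs (λ a → sum ys (g a)) ≡ sum ys (λ c → sum xs (λ a → g a c))
sum-swap []       ys g = sym (sum-zero ys)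
sum-swap (a ∷ as) ys g = trans (cong (sum ys (g a) +_) (sum-swap as ys g)) (sym (sum-+ ys (g a) _))

sum-filter : ∀ {P : A → Set} (P? : Decidable P) xs g →
             sum (filter P? xs) g ≡ sum xs (λ a → if does (P? a) then g a else 0ℚ)
sum-filter P? []       g = refl
sum-filter P? (a ∷ as) g with does (P? a)
... | true  = cong (g a +_) (sum-filter P? as g)
... | false = trans (sum-filter P? as g) (sym (+-identityˡ _))

-- Characters of 𝔽₂ⁿ

⟨⟩-comm : (a x : Cube n) → ⟨ a , x ⟩ ≡ ⟨ x , a ⟩
⟨⟩-comm []       []       = refl
⟨⟩-comm (a ∷ as) (x ∷ xs) = cong₂ _xor_ (∧-comm a x) (⟨⟩-comm as xs)

⟨⟩-⊕ˡ : (a b x : Cube n) → ⟨ a ⊕ b , x ⟩ ≡ ⟨ a , x ⟩ xor ⟨ b , x ⟩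
⟨⟩-⊕ˡ []       []       []       = refl
⟨⟩-⊕ˡ (a ∷ as) (b ∷ bs) (x ∷ xs) = trans (cong₂ _xor_ (∧-distribʳ-xor x a b) (⟨⟩-⊕ˡ as bs xs))
  (xor-interchange (a ∧ x) (b ∧ x) ⟨ as , xs ⟩ ⟨ bs , xs ⟩)

⟨⟩-⊕ʳ : (a x y : Cube n) → ⟨ a , x ⊕ y ⟩ ≡ ⟨ a , x ⟩ xor ⟨ a , y ⟩
⟨⟩-⊕ʳ a x y = trans (⟨⟩-comm a (x ⊕ y)) (trans (⟨⟩-⊕ˡ x y a) (cong₂ _xor_ (⟨⟩-comm x a) (⟨⟩-comm y a)))

⟨⟩-++ : (a x : Cube k) (b y : Cube n) → ⟨ a Vec.++ b , x Vec.++ y ⟩ ≡ ⟨ a , x ⟩ xor ⟨ b , y ⟩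
⟨⟩-++ []       []       b y = refl
⟨⟩-++ (a ∷ as) (x ∷ xs) b y = trans (cong ((a ∧ x) xor_) (⟨⟩-++ as xs b y))
  (sym (xor-assoc (a ∧ x) ⟨ as , xs ⟩ ⟨ b , y ⟩))

𝟎 : Cube n
𝟎 = Vec.replicate _ false

⟨⟩-zeroˡ : (x : Cube n) → ⟨ 𝟎 , x ⟩ ≡ false
⟨⟩-zeroˡ []       = refl
⟨⟩-zeroˡ (x ∷ xs) = ⟨⟩-zeroˡ xs

⟨⟩-zeroʳ : (a : Cube n) → ⟨ a , 𝟎 ⟩ ≡ false
⟨⟩-zeroʳ a = trans (⟨⟩-comm a 𝟎) (⟨⟩-zeroˡ a)

sign : Bool → ℚ
sign false = 1ℚ
sign true  = - 1ℚ

sign-xor : ∀ b c → sign (b xor c) ≡ sign b * sign c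
sign-xor false c     = sym (*-identityˡ (sign c))
sign-xor true  false = refl
sign-xor true  true  = refl

χ : Cube n → Cube n → ℚ
χ a x = sign ⟨ a , x ⟩

χ-𝟎 : (x : Cube n) → χ 𝟎 x ≡ 1ℚ
χ-𝟎 x = cong sign (⟨⟩-zeroˡ x)

χ-⊕ˡ : (a b x : Cube n) → χ (a ⊕ b) x ≡ χ a x * χ b x
χ-⊕ˡ a b x = trans (cong sign (⟨⟩-⊕ˡ a b x)) (sign-xor ⟨ a , x ⟩ ⟨ b , x ⟩)

χ-++ : (a x : Cube k) (b y : Cube n) → χ (a Vec.++ b) (x Vec.++ y) ≡ χ a x * χ b y
χ-++ a x b y = trans (cong sign (⟨⟩-++ a x b y)) (sign-xor ⟨ a , x ⟩ ⟨ b , y ⟩)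

-- No factor 2⁻ⁿ, so the coefficient at `𝟎` is the plain sum of `F`, which is how expectations are
-- read off.
fourier : (Cube n → ℚ) → Cube n → ℚ
fourier F a = sum (cube _) (λ x → χ a x * F x)

-- On the side of the query where a branch is not followed, its two terms at frequencies `a` and
-- `a ⊕ b` cancel; on the other side they coincide. The factor 2 on the left replaces the division
-- in (1 ± `χ b`) / 2.
fourier-query : (b : Cube n) (g₀ g₁ F : Cube n → ℚ) →
  (∀ x → ⟨ b , x ⟩ ≡ false → F x ≡ g₀ x) → (∀ x → ⟨ b , x ⟩ ≡ true → F x ≡ g₁ x) → ∀ a →
  2ℚ * fourier F a ≡ (fourier g₀ a + fourier g₀ (a ⊕ b)) + (fourier g₁ a - fourier g₁ (a ⊕ b))
fourier-query {n} b g₀ g₁ F F₀ F₁ a = begin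
  2ℚ * fourier F a ≡⟨ sym (sum-*ˡ (cube n) 2ℚ _) ⟩
  sum (cube n) (λ x → 2ℚ * (χ a x * F x)) ≡⟨ sum-cong (cube n) pointwise ⟩
  sum (cube n) (λ x → (χ a x * g₀ x + χ (a ⊕ b) x * g₀ x) + (χ a x * g₁ x + - (χ (a ⊕ b) x * g₁ x)))
    ≡⟨ trans (sum-+ (cube n) _ _) (cong₂ _+_ (sum-+ (cube n) _ _) (trans (sum-+ (cube n) _ _)
        (cong (fourier g₁ a +_) (sum-neg (cube n) _)))) ⟩
  (fourier g₀ a + fourier g₀ (a ⊕ b)) + (fourier g₁ a - fourier g₁ (a ⊕ b)) ∎
  where
  open ≡-Reasoning
  pointwise : ∀ x → 2ℚ * (χ a x * F x) ≡
                    (χ a x * g₀ x + χ (a ⊕ b) x * g₀ x) + (χ a x * g₁ x + - (χ (a ⊕ b) x * g₁ x))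
  pointwise x rewrite χ-⊕ˡ a b x with ⟨ b , x ⟩ in eq
  ... | false rewrite F₀ x eq = solve 3 (λ s p q → con 2ℚ :* (s :* p) :=
          (s :* p :+ s :* con 1ℚ :* p) :+ (s :* q :+ :- (s :* con 1ℚ :* q))) refl (χ a x) (g₀ x) (g₁ x)
  ... | true  rewrite F₁ x eq = solve 3 (λ s p q → con 2ℚ :* (s :* q) :=
          (s :* p :+ s :* con (- 1ℚ) :* p) :+ (s :* q :+ :- (s :* con (- 1ℚ) :* q))) refl (χ a x) (g₀ x) (g₁ x)

-- The induction has to bound all frequencies at once, since a query of `b` brings in `a ⊕ b`. Four
-- coefficients of the subtrees bound twice the coefficient of the tree, so each query costs a
-- factor 2.
fourier-tree : (g : Cube n → A → ℚ) {D : ℚ} → 0ℚ ≤ D → (∀ v a → ∣ fourier (λ x → g x v) a ∣ ≤ D) →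
               ∀ T a → ∣ fourier (λ x → g x (run T x)) a ∣ ≤ 2ℚ ^ depth T * D
fourier-tree g {D} 0≤D bound (leaf v)    a = subst (_ ≤_) (sym (*-identityˡ D)) (bound v a)
fourier-tree {n} g {D} 0≤D bound (query b T) a = *-cancelˡ-≤ {2ℚ} (positive⁻¹ 2ℚ) (begin
  2ℚ * ∣ fourier F a ∣ ≡⟨ sym (∣p*q∣≡∣p∣*∣q∣ 2ℚ (fourier F a)) ⟩
  ∣ 2ℚ * fourier F a ∣ ≡⟨ cong ∣_∣ (fourier-query b (G false) (G true) F
                           (λ x eq → cong (λ c → g x (run (T c) x)) eq) (λ x eq → cong (λ c → g x (run (T c) x)) eq) a) ⟩
  ∣ (φ false a + φ false (a ⊕ b)) + (φ true a - φ true (a ⊕ b)) ∣ ≤⟨ ∣p+q∣≤∣p∣+∣q∣ (φ false a + φ false (a ⊕ b)) _ ⟩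
  ∣ φ false a + φ false (a ⊕ b) ∣ + ∣ φ true a - φ true (a ⊕ b) ∣
    ≤⟨ +-mono-≤ (∣p+q∣≤∣p∣+∣q∣ (φ false a) _) (∣p-q∣≤∣p∣+∣q∣ (φ true a) _) ⟩
  (∣ φ false a ∣ + ∣ φ false (a ⊕ b) ∣) + (∣ φ true a ∣ + ∣ φ true (a ⊕ b) ∣)
    ≤⟨ +-mono-≤ (+-mono-≤ (le₀ a) (le₀ (a ⊕ b))) (+-mono-≤ (le₁ a) (le₁ (a ⊕ b))) ⟩
  (E + E) + (E + E) ≡⟨ solve 2 (λ p d → (p :* d :+ p :* d) :+ (p :* d :+ p :* d) := con 2ℚ :* (con 2ℚ :* p :* d)) refl
                        (2ℚ ^ (depth (T false) ℕ.⊔ depth (T true))) D ⟩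
  2ℚ * (2ℚ ^ depth (query b T) * D) ∎)
  where
  open ≤-Reasoning
  G : Bool → Cube n → ℚ
  G c x = g x (run (T c) x)
  F : Cube n → ℚ
  F x = g x (run (query b T) x)
  φ : Bool → Cube n → ℚ
  φ c = fourier (G c)
  E : ℚ
  E = 2ℚ ^ (depth (T false) ℕ.⊔ depth (T true)) * D
  le₀ : ∀ a → ∣ φ false a ∣ ≤ E
  le₀ a = ≤-trans (fourier-tree g 0≤D bound (T false) a)
    (*-monoʳ-≤ 0≤D (2^-mono (ℕₚ.m≤m⊔n (depth (T false)) (depth (T true)))))
  le₁ : ∀ a → ∣ φ true a ∣ ≤ E
  le₁ a = ≤-trans (fourier-tree g 0≤D bound (T true) a)
    (*-monoʳ-≤ 0≤D (2^-mono (ℕₚ.m≤n⊔m (depth (T false)) (depth (T true)))))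

-- Products over blocks

blocks : ∀ k → Cube (k ℕ.* n) → Vec (Cube n) k
blocks {n} k x = proj₁ (Vec.group k n x)

blocks-++ : ∀ k (x : Cube n) (y : Cube (k ℕ.* n)) → blocks (suc k) (x Vec.++ y) ≡ x ∷ blocks k y
blocks-++ {n} k x y = cong₂ (λ u v → u ∷ blocks k v) (proj₁ split) (proj₂ split)
  where
  split = ++-injective (Vec.take n (x Vec.++ y)) x (take++drop≡id n (x Vec.++ y))

sum-cube-∷ : ∀ n (F : Cube (suc n) → ℚ) →
             sum (cube (suc n)) F ≡ sum (cube n) (λ x → F (false ∷ x)) + sum (cube n) (λ x → F (true ∷ x))
sum-cube-∷ n F = trans (sum-++ (map (false ∷_) (cube n)) _ F)
  (cong₂ _+_ (sum-map (false ∷_) (cube n) F) (sum-map (true ∷_) (cube n) F))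

sum-cube-++ : ∀ m (F : Cube (m ℕ.+ n) → ℚ) →
              sum (cube (m ℕ.+ n)) F ≡ sum (cube m) (λ x → sum (cube n) (λ y → F (x Vec.++ y)))
sum-cube-++ zero F = sym (+-identityʳ _)
sum-cube-++ {n} (suc m) F = trans (sum-cube-∷ (m ℕ.+ n) F)
  (trans (cong₂ _+_ (sum-cube-++ m (λ x → F (false ∷ x))) (sum-cube-++ m (λ x → F (true ∷ x))))
    (sym (sum-cube-∷ m (λ x → sum (cube n) (λ y → F (x Vec.++ y))))))

sum-cube-* : ∀ m (F : Cube (m ℕ.+ n) → ℚ) (P : Cube m → ℚ) (Q : Cube n → ℚ) →
             (∀ x y → F (x Vec.++ y) ≡ P x * Q y) → sum (cube (m ℕ.+ n)) F ≡ sum (cube m) P * sum (cube n) Q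
sum-cube-* {n} m F P Q eq = begin
  sum (cube (m ℕ.+ n)) F                                        ≡⟨ sum-cube-++ m F ⟩
  sum (cube m) (λ x → sum (cube n) (λ y → F (x Vec.++ y)))      ≡⟨ sum-cong (cube m) (λ x →
    trans (sum-cong (cube n) (eq x)) (sum-*ˡ (cube n) (P x) Q)) ⟩
  sum (cube m) (λ x → P x * sum (cube n) Q)                     ≡⟨ sum-*ʳ (cube m) (sum (cube n) Q) P ⟩
  sum (cube m) P * sum (cube n) Q                               ∎
  where open ≡-Reasoning

∏ : (A → ℚ) → Vec A k → ℚ
∏ g []       = 1ℚ
∏ g (x ∷ xs) = g x * ∏ g xs

∏₂ : (A → C → ℚ) → Vec A k → Vec C k → ℚ
∏₂ h []       []       = 1ℚ
∏₂ h (x ∷ xs) (y ∷ ys) = h x y * ∏₂ h xs ys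

∏-∏₂ : ∀ {B : Set} (g : A → ℚ) (h : B → C → ℚ) (f : A → B) (xs : Vec A k) ys →
       ∏₂ (λ x y → g x * h (f x) y) xs ys ≡ ∏ g xs * ∏₂ h (Vec.map f xs) ys
∏-∏₂ g h f []       []       = refl
∏-∏₂ g h f (x ∷ xs) (y ∷ ys) = trans (cong (g x * h (f x) y *_) (∏-∏₂ g h f xs ys))
  (solve 4 (λ a b c d → a :* b :* (c :* d) := a :* c :* (b :* d)) refl
    (g x) (h (f x) y) (∏ g xs) (∏₂ h (Vec.map f xs) ys))

0≤∏ : (g : A → ℚ) → (∀ a → 0ℚ ≤ g a) → (xs : Vec A k) → 0ℚ ≤ ∏ g xs
0≤∏ g 0≤g []       = nonNegative⁻¹ 1ℚ
0≤∏ g 0≤g (x ∷ xs) = 0≤p*q (0≤g x) (0≤∏ g 0≤g xs)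

sum-blocks : ∀ k (g : Cube n → ℚ) → sum (cube (k ℕ.* n)) (λ x → ∏ g (blocks k x)) ≡ sum (cube n) g ^ k
sum-blocks zero g = refl
sum-blocks {n} (suc k) g = trans
  (sum-cube-* n (λ x → ∏ g (blocks (suc k) x)) g (λ y → ∏ g (blocks k y)) (λ x y → cong (∏ g) (blocks-++ k x y)))
  (cong (sum (cube n) g *_) (sum-blocks k g))

-- The frequency splits into blocks along with the input and characters are multiplicative over
-- concatenation, so the coefficient is a product of one-block coefficients, each with its own
-- label.
fourier-blocks : (h : Cube n → C → ℚ) {B : ℚ} → (∀ v a → ∣ fourier (λ x → h x v) a ∣ ≤ B) →
                 ∀ k (vs : Vec C k) a → ∣ fourier (λ x → ∏₂ h (blocks k x) vs) a ∣ ≤ B ^ k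
fourier-blocks h bound zero    []       [] = ≤-refl
fourier-blocks {n} h {B} bound (suc k) (v ∷ vs) a with Vec.splitAt n a
... | a₁ , a₂ , refl = subst (λ z → ∣ z ∣ ≤ B ^ suc k)
  (sym (sum-cube-* n _ (λ x → χ a₁ x * h x v) (λ y → χ a₂ y * ∏₂ h (blocks k y) vs) factor))
  (∣p*q∣≤ (bound v a₁) (fourier-blocks h bound k vs a₂))
  where
  factor : ∀ x y → χ (a₁ Vec.++ a₂) (x Vec.++ y) * ∏₂ h (blocks (suc k) (x Vec.++ y)) (v ∷ vs)
                   ≡ (χ a₁ x * h x v) * (χ a₂ y * ∏₂ h (blocks k y) vs)
  factor x y = trans (cong₂ _*_ (χ-++ a₁ x a₂ y) (cong (λ z → ∏₂ h z (v ∷ vs)) (blocks-++ k x y)))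
    (solve 4 (λ p q r s → p :* q :* (r :* s) := p :* r :* (q :* s)) refl
      (χ a₁ x) (χ a₂ y) (h x v) (∏₂ h (blocks k y) vs))

-- A guarantee for every input is averaged over the product of `m`, and the sums over inputs and
-- trees are exchanged. Neither `w` nor `m` is assumed to have total 1, so both totals stay in the
-- inequality.
averaging : ∀ (k : ℕ) {I : Set} (is : List I) (w : I → ℚ) (T : I → PDT (k ℕ.* n) (Cube k)) {d : ℕ}
            (f : Cube n → Bool) (ψ : Bool → Bool → ℚ) (m : Cube n → ℚ) {B γ : ℚ} →
            (∀ i → 0ℚ ≤ w i) → (∀ i → depth (T i) ℕ.≤ d) → (∀ x → 0ℚ ≤ m x) → 0ℚ ≤ B →
            (∀ v a → ∣ fourier (λ x → m x * ψ (f x) v) a ∣ ≤ B) →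
            (∀ x → γ ≤ sum is (λ i → w i * ∏₂ ψ ((f ^ᵏ k) x) (run (T i) x))) →
            γ * sum (cube n) m ^ k ≤ sum is w * (2ℚ ^ d * B ^ k)
averaging {n} k is w T {d} f ψ m {B} {γ} 0≤w deep 0≤m 0≤B bound avg = begin
  γ * sum (cube n) m ^ k                                 ≡⟨ cong (γ *_) (sym (sum-blocks k m)) ⟩
  γ * sum (cube (k ℕ.* n)) M                             ≡⟨ sym (sum-*ˡ (cube (k ℕ.* n)) γ M) ⟩
  sum (cube (k ℕ.* n)) (λ x → γ * M x)                   ≤⟨ sum-mono (cube (k ℕ.* n)) (λ x →
    *-monoʳ-≤ (0≤∏ m 0≤m (blocks k x)) (avg x)) ⟩
  sum (cube (k ℕ.* n)) (λ x → sum is (λ i → w i * H i x) * M x)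
    ≡⟨ sum-cong (cube (k ℕ.* n)) (λ x → sym (sum-*ʳ is (M x) (λ i → w i * H i x))) ⟩
  sum (cube (k ℕ.* n)) (λ x → sum is (λ i → w i * H i x * M x)) ≡⟨ sum-swap (cube (k ℕ.* n)) is _ ⟩
  sum is (λ i → sum (cube (k ℕ.* n)) (λ x → w i * H i x * M x))
    ≡⟨ sum-cong is (λ i → trans (sum-cong (cube (k ℕ.* n)) (reorder i)) (sum-*ˡ (cube (k ℕ.* n)) (w i) _)) ⟩
  sum is (λ i → w i * fourier (λ x → ∏₂ h (blocks k x) (run (T i) x)) 𝟎)
    ≤⟨ sum-mono is (λ i → *-monoˡ-≤ (0≤w i) (single i)) ⟩
  sum is (λ i → w i * (2ℚ ^ d * B ^ k))                  ≡⟨ sum-*ʳ is (2ℚ ^ d * B ^ k) w ⟩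
  sum is w * (2ℚ ^ d * B ^ k)                            ∎
  where
  open ≤-Reasoning
  M : Cube (k ℕ.* n) → ℚ
  M x = ∏ m (blocks k x)
  H : _ → Cube (k ℕ.* n) → ℚ
  H i x = ∏₂ ψ ((f ^ᵏ k) x) (run (T i) x)
  h : Cube n → Bool → ℚ
  h x v = m x * ψ (f x) v
  -- Inserting `χ 𝟎 x`, which is 1, turns the expected payoff of one tree into a Fourier
  -- coefficient.
  reorder : ∀ i x → w i * H i x * M x ≡ w i * (χ 𝟎 x * ∏₂ h (blocks k x) (run (T i) x))
  reorder i x = trans (solve 3 (λ p q r → p :* q :* r := p :* (con 1ℚ :* (r :* q))) refl (w i) (H i x) (M x))
    (cong (w i *_) (sym (cong₂ _*_ (χ-𝟎 x) (∏-∏₂ m ψ f (blocks k x) (run (T i) x)))))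
  single : ∀ i → fourier (λ x → ∏₂ h (blocks k x) (run (T i) x)) 𝟎 ≤ 2ℚ ^ d * B ^ k
  single i = ≤-trans (p≤∣p∣ _) (≤-trans
    (fourier-tree (λ x → ∏₂ h (blocks k x)) (0≤p^n k 0≤B) (fourier-blocks h bound k) (T i) 𝟎)
    (*-monoʳ-≤ (0≤p^n k 0≤B) (2^-mono (deep i))))

-- Natural numbers as rationals, and Archimedean bounds

ι : ℕ → ℚ
ι n = ℤ.+ n / 1

toℚᵘ-ι : ∀ n → toℚᵘ (ι n) ℚᵘ.≃ ℚᵘ.mkℚᵘ (ℤ.+ n) 0
toℚᵘ-ι n = toℚᵘ-fromℚᵘ (ℚᵘ.mkℚᵘ (ℤ.+ n) 0)

ι-+ : ∀ m n → ι (m ℕ.+ n) ≡ ι m + ι n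
ι-+ m n = toℚᵘ-injective (ℚᵘₚ.≃-trans (toℚᵘ-ι (m ℕ.+ n)) (ℚᵘₚ.≃-trans
  (ℚᵘ.*≡* (cong (ℤ._* ℤ.+ 1) (sym (cong₂ ℤ._+_ (ℤₚ.*-identityʳ (ℤ.+ m)) (ℤₚ.*-identityʳ (ℤ.+ n))))))
  (ℚᵘₚ.≃-sym (ℚᵘₚ.≃-trans (toℚᵘ-homo-+ (ι m) (ι n)) (ℚᵘₚ.+-cong (toℚᵘ-ι m) (toℚᵘ-ι n))))))

ι-* : ∀ m n → ι (m ℕ.* n) ≡ ι m * ι n
ι-* m n = toℚᵘ-injective (ℚᵘₚ.≃-trans (toℚᵘ-ι (m ℕ.* n)) (ℚᵘₚ.≃-trans
  (ℚᵘ.*≡* (cong (ℤ._* ℤ.+ 1) (ℤₚ.pos-* m n)))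
  (ℚᵘₚ.≃-sym (ℚᵘₚ.≃-trans (toℚᵘ-homo-* (ι m) (ι n)) (ℚᵘₚ.*-cong (toℚᵘ-ι m) (toℚᵘ-ι n))))))

0≤ι : ∀ n → 0ℚ ≤ ι n
0≤ι n = toℚᵘ-cancel-≤ (ℚᵘₚ.≤-respʳ-≃ (ℚᵘₚ.≃-sym (toℚᵘ-ι n)) (ℚᵘₚ.nonNegative⁻¹ (ℚᵘ.mkℚᵘ (ℤ.+ n) 0)))

ι-mono : ∀ {m n} → m ℕ.≤ n → ι m ≤ ι n
ι-mono {m} {n} m≤n = ≤-gap (ι (n ℕ.∸ m)) (0≤ι (n ℕ.∸ m))
  (trans (sym (ι-+ m (n ℕ.∸ m))) (cong ι (ℕₚ.m+[n∸m]≡n m≤n)))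

0<ι : ∀ {n} → 0 ℕ.< n → 0ℚ < ι n
0<ι 0<n = <-≤-trans (positive⁻¹ 1ℚ) (ι-mono 0<n)

1≤2^ : ∀ n → 1ℚ ≤ 2ℚ ^ n
1≤2^ n = 1≤p^n n (≤ᵇ⇒≤ _)

ι≤2^ : ∀ n → ι n ≤ 2ℚ ^ n
ι≤2^ zero    = ≤ᵇ⇒≤ _
ι≤2^ (suc n) = begin
  ι (suc n)         ≡⟨ ι-+ 1 n ⟩
  1ℚ + ι n          ≤⟨ +-mono-≤ (1≤2^ n) (ι≤2^ n) ⟩
  2ℚ ^ n + 2ℚ ^ n   ≡⟨ solve 1 (λ p → p :+ p := con 2ℚ :* p) refl (2ℚ ^ n) ⟩
  2ℚ ^ suc n        ∎
  where open ≤-Reasoning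

p≤ι∣↥p∣ : ∀ p → p ≤ ι ℤ.∣ ↥ p ∣
p≤ι∣↥p∣ p@record{} = toℚᵘ-cancel-≤ (ℚᵘₚ.≤-respʳ-≃ (ℚᵘₚ.≃-sym (toℚᵘ-ι ℤ.∣ ↥ p ∣)) (ℚᵘ.*≤* (begin
  ↥ p ℤ.* ℤ.+ 1             ≡⟨ ℤₚ.*-identityʳ (↥ p) ⟩
  ↥ p                       ≤⟨ i≤+∣i∣ (↥ p) ⟩
  ℤ.+ ℤ.∣ ↥ p ∣              ≡⟨ sym (ℤₚ.*-identityʳ _) ⟩
  ℤ.+ ℤ.∣ ↥ p ∣ ℤ.* ℤ.+ 1     ≤⟨ ℤₚ.*-monoˡ-≤-nonNeg (ℤ.+ ℤ.∣ ↥ p ∣) (ℤ.+≤+ (ℕ.s≤s ℕ.z≤n)) ⟩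
  ℤ.+ ℤ.∣ ↥ p ∣ ℤ.* ↧ p      ∎)))
  where
  open ℤₚ.≤-Reasoning
  i≤+∣i∣ : ∀ i → i ℤ.≤ ℤ.+ ℤ.∣ i ∣
  i≤+∣i∣ (ℤ.+ _)    = ℤₚ.≤-refl
  i≤+∣i∣ ℤ.-[1+ _ ] = ℤ.-≤+

½^*2^ : ∀ j → ½ ^ j * 2ℚ ^ j ≡ 1ℚ
½^*2^ j = trans (sym (^-distribʳ-* ½ 2ℚ j)) (1^n≡1 j)

0≤½^ : ∀ n → 0ℚ ≤ ½ ^ n
0≤½^ n = 0≤p^n n (nonNegative⁻¹ ½)

-- With `j` the absolute value of the numerator of `r`, r ≤ j ≤ 2ʲ, so `j` further halvings absorb
-- `r`.
scale-below : ∀ i r → ∃[ N ] ½ ^ N * r ≤ ½ ^ i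
scale-below i r = i ℕ.+ j , (begin
  ½ ^ (i ℕ.+ j) * r          ≡⟨ trans (cong (_* r) (^-distribˡ-+-* ½ i j)) (*-assoc (½ ^ i) (½ ^ j) r) ⟩
  ½ ^ i * (½ ^ j * r)        ≤⟨ *-monoˡ-≤ (0≤½^ i) (*-monoˡ-≤ (0≤½^ j) (≤-trans (p≤ι∣↥p∣ r) (ι≤2^ j))) ⟩
  ½ ^ i * (½ ^ j * 2ℚ ^ j)   ≡⟨ trans (cong (½ ^ i *_) (½^*2^ j)) (*-identityʳ (½ ^ i)) ⟩
  ½ ^ i                      ∎)
  where
  open ≤-Reasoning
  j = ℤ.∣ ↥ r ∣

-- Rational approximation of reals

infix 4 _≈_±_
-- This says that the real `x` is within `ε` of `q`; the extra `½ ^ n` is the distance that the n-th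
-- term may have from `x`. Two one-sided inequalities avoid absolute values of differences.
record _≈_±_ (x : ℝ) (q ε : ℚ) : Set where
  field
    seq≤ : ∀ n → seq x n ≤ q + (ε + ½ ^ n)
    ≤seq : ∀ n → q ≤ seq x n + (ε + ½ ^ n)

open _≈_±_

∣p-q∣≤⇒p≤q+ : ∀ p q {b} → ∣ p - q ∣ ≤ b → p ≤ q + b
∣p-q∣≤⇒p≤q+ p q {b} le = subst (_≤ q + b) (solve 2 (λ p q → q :+ (p :- q) := p) refl p q)
  (+-monoʳ-≤ q (≤-trans (p≤∣p∣ (p - q)) le))

≈-seq : ∀ x n → x ≈ seq x n ± ½ ^ n
≈-seq x n = record
  { seq≤ = λ i → ∣p-q∣≤⇒p≤q+ (seq x i) (seq x n)
      (subst (∣ seq x i - seq x n ∣ ≤_) (+-comm (½ ^ i) (½ ^ n)) (regular x i n))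
  ; ≤seq = λ i → ∣p-q∣≤⇒p≤q+ (seq x n) (seq x i) (regular x n i)
  }

≈-fromℚ : ∀ q → fromℚ q ≈ q ± 0ℚ
≈-fromℚ q = record { seq≤ = le ; ≤seq = le }
  where
  le : ∀ n → q ≤ q + (0ℚ + ½ ^ n)
  le n = ≤-gap (0ℚ + ½ ^ n) (0≤p+q ≤-refl (0≤½^ n)) refl

≈-weaken : ε ≤ δ → x ≈ q ± ε → x ≈ q ± δ
≈-weaken {x = x} {q} ε≤δ x≈q = record
  { seq≤ = λ n → ≤-trans (seq≤ x≈q n) (+-monoʳ-≤ q (+-monoˡ-≤ (½ ^ n) ε≤δ))
  ; ≤seq = λ n → ≤-trans (≤seq x≈q n) (+-monoʳ-≤ (seq x n) (+-monoˡ-≤ (½ ^ n) ε≤δ))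
  }

≈-shift : ∀ d → 0ℚ ≤ d → x ≈ q ± ε → x ≈ q + d ± (ε + d)
≈-shift {x} {q} {ε} d 0≤d x≈q = record
  { seq≤ = λ n → ≤-trans (seq≤ x≈q n) (≤-gap (d + d) (0≤p+q 0≤d 0≤d)
      (solve 4 (λ q ε h d → q :+ (ε :+ h) :+ (d :+ d) := q :+ d :+ (ε :+ d :+ h)) refl q ε (½ ^ n) d))
  ; ≤seq = λ n → subst (q + d ≤_)
      (solve 4 (λ s ε h d → s :+ (ε :+ h) :+ d := s :+ (ε :+ d :+ h)) refl (seq x n) ε (½ ^ n) d)
      (+-monoˡ-≤ d (≤seq x≈q n))
  }

≈-+ : x ≈ p ± ε → y ≈ q ± δ → x +ʳ y ≈ p + q ± (ε + δ)
≈-+ {x} {p} {ε} {y} {q} {δ} x≈p y≈q = record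
  { seq≤ = λ n → subst (seq x (suc n) + seq y (suc n) ≤_) (merge p q (½ ^ n))
      (+-mono-≤ (seq≤ x≈p (suc n)) (seq≤ y≈q (suc n)))
  ; ≤seq = λ n → subst (p + q ≤_) (merge (seq x (suc n)) (seq y (suc n)) (½ ^ n))
      (+-mono-≤ (≤seq x≈p (suc n)) (≤seq y≈q (suc n)))
  }
  where
  -- `_+ʳ_` reads its arguments at `suc n`, so their two slacks add up to the single slack `h` at
  -- `n`.
  merge : ∀ a b h → (a + (ε + ½ * h)) + (b + (δ + ½ * h)) ≡ a + b + (ε + δ + h)
  merge a b h = solve 5
    (λ a b ε δ h → (a :+ (ε :+ con ½ :* h)) :+ (b :+ (δ :+ con ½ :* h)) := a :+ b :+ (ε :+ δ :+ h)) refl a b ε δ h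

≤+⇒-≤-+ : ∀ a b c → a ≤ b + c → - b ≤ - a + c
≤+⇒-≤-+ a b c le = subst₂ _≤_ (solve 2 (λ a b → a :+ (:- a :- b) := :- b) refl a b)
  (solve 3 (λ a b c → (b :+ c) :+ (:- a :- b) := :- a :+ c) refl a b c) (+-monoˡ-≤ (- a - b) le)

≈-neg : x ≈ q ± ε → -ʳ x ≈ - q ± ε
≈-neg {x} {q} {ε} x≈q = record
  { seq≤ = λ n → ≤+⇒-≤-+ q (seq x n) (ε + ½ ^ n) (≤seq x≈q n)
  ; ≤seq = λ n → ≤+⇒-≤-+ (seq x n) q (ε + ½ ^ n) (seq≤ x≈q n)
  }

∣∣-≤+ : ∀ a b c → a ≤ b + c → b ≤ a + c → ∣ a ∣ ≤ ∣ b ∣ + c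
∣∣-≤+ a b c a≤ b≤ = ∣p∣≤ (≤-trans a≤ (+-monoˡ-≤ c (p≤∣p∣ b)))
  (≤-trans (≤+⇒-≤-+ b a c b≤) (+-monoˡ-≤ c (-p≤∣p∣ b)))

≈-abs : x ≈ q ± ε → ∣ x ∣ʳ ≈ ∣ q ∣ ± ε
≈-abs {x} {q} {ε} x≈q = record
  { seq≤ = λ n → ∣∣-≤+ (seq x n) q (ε + ½ ^ n) (seq≤ x≈q n) (≤seq x≈q n)
  ; ≤seq = λ n → ∣∣-≤+ q (seq x n) (ε + ½ ^ n) (≤seq x≈q n) (seq≤ x≈q n)
  }

≈-∑ : ∀ (xs : List A) {w m ε} → (∀ a → w a ≈ m a ± ε) → ∑ xs w ≈ sum xs m ± sum xs (λ _ → ε)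
≈-∑ []       w≈m = ≈-fromℚ 0ℚ
≈-∑ (a ∷ as) w≈m = ≈-+ (w≈m a) (≈-∑ as w≈m)

-- Of the four slacks `½ ^ n`, each approximation contributes one and `_≤ʳ_` two.
≤ʳ⇒≤ : x ≤ʳ y → x ≈ p ± ε → y ≈ q ± δ → ∀ n → p ≤ q + (ε + δ + ι 4 * ½ ^ n)
≤ʳ⇒≤ {x} {y} {p} {ε} {q} {δ} x≤y x≈p y≈q n = begin
  p                                              ≤⟨ ≤seq x≈p n ⟩
  seq x n + (ε + h)                              ≤⟨ +-monoˡ-≤ (ε + h) (x≤y n) ⟩
  seq y n + (h + h) + (ε + h)                    ≤⟨ +-monoˡ-≤ (ε + h) (+-monoˡ-≤ (h + h) (seq≤ y≈q n)) ⟩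
  q + (δ + h) + (h + h) + (ε + h)
    ≡⟨ solve 4 (λ q ε δ h → q :+ (δ :+ h) :+ (h :+ h) :+ (ε :+ h) := q :+ (ε :+ δ :+ con (ι 4) :* h)) refl q ε δ h ⟩
  q + (ε + δ + ι 4 * h)                          ∎
  where
  open ≤-Reasoning
  h = ½ ^ n

sum-filter-≤ : ∀ {P : A → Set} (P? : Decidable P) xs {ε} → 0ℚ ≤ ε → sum (filter P? xs) (λ _ → ε) ≤ sum xs (λ _ → ε)
sum-filter-≤ P? xs {ε} 0≤ε = subst (_≤ sum xs (λ _ → ε)) (sym (sum-filter P? xs _))
  (sum-mono xs (λ a → le (does (P? a))))
  where
  le : ∀ b → (if b then ε else 0ℚ) ≤ ε
  le true  = ≤-refl
  le false = 0≤ε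

-- A family of reals is replaced by nonnegative rationals. `κ` bounds the error this causes in an
-- inequality about the sum over `xs` or over any filtered part of it, and `r` is the factor by
-- which the application amplifies that error.
record Snapshot (w : A → ℝ) (xs : List A) (i : ℕ) (r : ℚ) : Set where
  field
    value    : A → ℚ
    0≤value  : ∀ a → 0ℚ ≤ value a
    radius   : ℚ
    0≤radius : 0ℚ ≤ radius
    w≈value  : ∀ a → w a ≈ value a ± radius
    index    : ℕ

  κ : ℚ
  κ = sum xs (λ _ → radius) + ι 4 * ½ ^ index

  field
    small : κ * r ≤ ½ ^ i

  mass≥ : 1ℝ ≤ʳ ∑ xs w → 1ℚ ≤ sum xs value + κ
  mass≥ 1≤∑ = subst (1ℚ ≤_)
    (cong (λ z → sum xs value + (z + ι 4 * ½ ^ index)) (+-identityˡ (sum xs (λ _ → radius))))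
    (≤ʳ⇒≤ 1≤∑ (≈-fromℚ 1ℚ) (≈-∑ xs w≈value) index)

  filtered-≤ : ∀ {P : A → Set} (P? : Decidable P) {x y p b δ} →
               x ≤ʳ y → x ≈ p ± sum (filter P? xs) (λ _ → radius) → y ≈ b ± δ → p ≤ b + (δ + κ)
  filtered-≤ P? {x} {y} {p} {b} {δ} x≤y x≈p y≈b = subst (p ≤_)
    (solve 4 (λ b E δ h → b :+ (E :+ δ :+ h) := b :+ (δ :+ (E :+ h))) refl
      b (sum xs (λ _ → radius)) δ (ι 4 * ½ ^ index))
    (≤ʳ⇒≤ x≤y (≈-weaken (sum-filter-≤ P? xs 0≤radius) x≈p) y≈b index)

-- Rounding up by 2·2⁻ᴺ keeps the approximations of nonnegative reals nonnegative.
snapshot : ∀ (w : A → ℝ) → (∀ a → 0ℝ ≤ʳ w a) → ∀ xs i r → Snapshot w xs i r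
snapshot w 0≤w xs i r = record
  { value    = λ a → seq (w a) N + (h + h)
  ; 0≤value  = λ a → 0≤w a N
  ; radius   = h + (h + h)
  ; 0≤radius = 0≤p+q {h} {h + h} (0≤½^ N) 0≤h+h
  ; w≈value  = λ a → ≈-shift (h + h) 0≤h+h (≈-seq (w a) N)
  ; index    = N
  ; small    = subst (_≤ ½ ^ i) (sym factor) (proj₂ scaled)
  }
  where
  L : ℚ
  L = sum xs (λ _ → 1ℚ)
  -- `L` is the length of `xs`; a radius of 3h for each member and the 4h of `≤ʳ⇒≤` make `κ` equal
  -- to (3L + 4)h.
  scaled = scale-below i ((ι 3 * L + ι 4) * r)
  N : ℕ
  N = proj₁ scaled
  h : ℚ
  h = ½ ^ N
  0≤h+h : 0ℚ ≤ h + h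
  0≤h+h = 0≤p+q {h} {h} (0≤½^ N) (0≤½^ N)
  factor : (sum xs (λ _ → h + (h + h)) + ι 4 * h) * r ≡ h * ((ι 3 * L + ι 4) * r)
  factor = trans (cong (λ z → (z + ι 4 * h) * r) 
      (trans (sum-cong xs (λ _ → sym (*-identityʳ _))) (sum-*ˡ xs (h + (h + h)) (λ _ → 1ℚ))))
    (solve 3 (λ h L r → ((h :+ (h :+ h)) :* L :+ con (ι 4) :* h) :* r := h :* ((con (ι 3) :* L :+ con (ι 4)) :* r)) refl
      h L r)

-- Randomised trees

-- This is spelled as in `errorAt`, so that the filtered lists agree by definition.
mismatch : ∀ {N m} (g : Cube N → Cube m) ((𝒯 , _) : Computable g d) x →
           Decidable (λ i → run (RandomisedPDT.tree 𝒯 i) x ≢ g x)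
mismatch g (𝒯 , _) x i = ¬? (≡-dec _≟ᵇ_ (run (RandomisedPDT.tree 𝒯 i) x) (g x))

-- Rounding moves the total away from 1, so the error is measured as a fraction `η` of the total
-- instead of renormalising.
RationalWeights : ∀ {N m} (g : Cube N → Cube m) → Computable g d → ℚ → Set
RationalWeights g c@(𝒯 , _) η = ∃[ w ] (∀ i → 0ℚ ≤ w i) × 0ℚ < sum (allFin size) w ×
    (∀ x → sum (filter (mismatch g c x) (allFin size)) w ≤ η * sum (allFin size) w)
  where open RandomisedPDT 𝒯

-- Any error strictly between 1/3 and 1/2 would do.
rational-weights : ∀ {N m} (g : Cube N → Cube m) (c : Computable g d) → RationalWeights g c (ℤ.+ 2 / 5)
rational-weights g c@(𝒯 , err) = value , 0≤value , <-≤-trans (positive⁻¹ (ℤ.+ 31 / 32)) W≥ , λ x → begin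
    sum (filter (mismatch g c x) is) value
      ≤⟨ filtered-≤ (mismatch g c x) (err x) (≈-∑ (filter (mismatch g c x) is) w≈value) (≈-fromℚ (ℤ.+ 1 / 3)) ⟩
    ℤ.+ 1 / 3 + (0ℚ + κ)               ≤⟨ +-monoʳ-≤ (ℤ.+ 1 / 3) (+-monoʳ-≤ 0ℚ κ≤) ⟩
    -- Precision 2⁻⁵ suffices: 1/3 + 1/32 = 35/96 is below 2/5 · 31/32 = 31/80.
    ℤ.+ 1 / 3 + (0ℚ + ½ ^ 5)           ≤⟨ ≤ᵇ⇒≤ _ ⟩
    ℤ.+ 2 / 5 * (ℤ.+ 31 / 32)          ≤⟨ *-monoˡ-≤ (nonNegative⁻¹ (ℤ.+ 2 / 5)) W≥ ⟩
    ℤ.+ 2 / 5 * W                      ∎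
  where
  open ≤-Reasoning
  open RandomisedPDT 𝒯 using (size; weight)
  is : List (Fin size)
  is = allFin size
  open Snapshot (snapshot weight (RandomisedPDT.nonNeg 𝒯) is 5 1ℚ)
  W : ℚ
  W = sum is value
  κ≤ : κ ≤ ½ ^ 5
  κ≤ = subst (_≤ ½ ^ 5) (*-identityʳ κ) small
  W≥ : ℤ.+ 31 / 32 ≤ W
  W≥ = subst (ℤ.+ 31 / 32 ≤_) (solve 2 (λ W κ → W :+ κ :- κ := W) refl W κ)
    (+-mono-≤ (mass≥ (proj₂ (RandomisedPDT.total 𝒯))) (neg-antimono-≤ κ≤))

-- Full payoff would give the whole weight; members satisfying `P` lose at most `λ′` per unit of
-- weight, and they carry at most the fraction `η`.
score≥ : ∀ {P : A → Set} (P? : Decidable P) xs (w H : A → ℚ) {η λ′} → 0ℚ ≤ λ′ →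
         (∀ a → w a - λ′ * (if does (P? a) then w a else 0ℚ) ≤ w a * H a) →
         sum (filter P? xs) w ≤ η * sum xs w → (1ℚ - λ′ * η) * sum xs w ≤ sum xs (λ a → w a * H a)
score≥ P? xs w H {η} {λ′} 0≤λ′ pointwise wrong≤ = begin
  (1ℚ - λ′ * η) * W
    ≡⟨ solve 3 (λ W l η → (con 1ℚ :- l :* η) :* W := W :- l :* (η :* W)) refl W λ′ η ⟩
  W - λ′ * (η * W)                           ≤⟨ +-monoʳ-≤ W (neg-antimono-≤ (*-monoˡ-≤ 0≤λ′ wrong≤)) ⟩
  W - λ′ * sum (filter P? xs) w              ≡⟨ cong (λ z → W - λ′ * z) (sum-filter P? xs w) ⟩
  W - λ′ * sum xs wrong
    ≡⟨ cong (W +_) (trans (cong -_ (sym (sum-*ˡ xs λ′ wrong))) (sym (sum-neg xs (λ a → λ′ * wrong a)))) ⟩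
  W + sum xs (λ a → - (λ′ * wrong a))         ≡⟨ sym (sum-+ xs w (λ a → - (λ′ * wrong a))) ⟩
  sum xs (λ a → w a - λ′ * wrong a)          ≤⟨ sum-mono xs pointwise ⟩
  sum xs (λ a → w a * H a)                   ∎
  where
  open ≤-Reasoning
  W : ℚ
  W = sum xs w
  wrong : _ → ℚ
  wrong a = if does (P? a) then w a else 0ℚ

-- `λ′` bounds the loss caused by a wrong output vector, however many of its bits are wrong: 1 for
-- the equality test, 2 for signs.
record Payoff (ψ : Bool → Bool → ℚ) (λ′ : ℚ) : Set where
  field
    0≤λ′    : 0ℚ ≤ λ′
    correct : (y : Cube k) → ∏₂ ψ y y ≡ 1ℚ
    wrong   : (y v : Cube k) → 1ℚ - λ′ ≤ ∏₂ ψ y v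

  payoff≥ : {y v : Cube k} (v≟y : Dec (v ≡ y)) {w : ℚ} → 0ℚ ≤ w →
            w - λ′ * (if does (¬? v≟y) then w else 0ℚ) ≤ w * ∏₂ ψ y v
  payoff≥ {y = y} (yes refl) {w} _ = ≤-reflexive (trans
    (solve 2 (λ w l → w :- l :* con 0ℚ := w :* con 1ℚ) refl w λ′)
    (cong (w *_) (sym (correct y))))
  payoff≥ {y = y} {v} (no _) {w} 0≤w = subst (_≤ w * ∏₂ ψ y v)
    (solve 2 (λ w l → w :* (con 1ℚ :- l) := w :- l :* w) refl w λ′) (*-monoˡ-≤ 0≤w (wrong y v))

-- `score≥` supplies the guarantee that `averaging` asks for; the total tree weight `W` then appears
-- on both sides and cancels.
direct-sum : ∀ (f : Cube n → Bool) (c : Computable (f ^ᵏ k) d) η → RationalWeights (f ^ᵏ k) c η →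
             ∀ {ψ λ′} → Payoff ψ λ′ →
             ∀ (m : Cube n → ℚ) {B} → (∀ x → 0ℚ ≤ m x) → 0ℚ ≤ B →
             (∀ v a → ∣ fourier (λ x → m x * ψ (f x) v) a ∣ ≤ B) →
             (1ℚ - λ′ * η) * sum (cube n) m ^ k ≤ 2ℚ ^ d * B ^ k
direct-sum {n} {k} {d} f c@(𝒯 , _) η (w , 0≤w , 0<W , err≤) {ψ} {λ′} payoff m {B} 0≤m 0≤B bound =
  *-cancelˡ-≤ 0<W (subst (_≤ W * (2ℚ ^ d * B ^ k))
  (solve 3 (λ W γ s → (γ :* W) :* s := W :* (γ :* s)) refl W (1ℚ - λ′ * η) (sum (cube n) m ^ k))
  (averaging k is w tree f ψ m 0≤w bounded 0≤m 0≤B bound avg))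
  where
  open RandomisedPDT 𝒯
  open Payoff payoff
  is : List (Fin size)
  is = allFin size
  W : ℚ
  W = sum is w
  avg : ∀ x → (1ℚ - λ′ * η) * W ≤ sum is (λ i → w i * ∏₂ ψ ((f ^ᵏ k) x) (run (tree i) x))
  avg x = score≥ (mismatch (f ^ᵏ k) c x) is w _ 0≤λ′
    (λ i → payoff≥ (≡-dec _≟ᵇ_ (run (tree i) x) ((f ^ᵏ k) x)) (0≤w i)) (err≤ x)

-- The equality payoff and nonconstant functions

agree : Bool → Bool → ℚ
agree b c = if b xor c then 0ℚ else 1ℚ

0≤∏₂agree : (y v : Cube k) → 0ℚ ≤ ∏₂ agree y v
0≤∏₂agree []       []       = nonNegative⁻¹ 1ℚ
0≤∏₂agree (y ∷ ys) (v ∷ vs) = 0≤p*q (le (y xor v)) (0≤∏₂agree ys vs)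
  where
  le : ∀ b → 0ℚ ≤ (if b then 0ℚ else 1ℚ)
  le true  = ≤-refl
  le false = nonNegative⁻¹ 1ℚ

∏₂agree-refl : (y : Cube k) → ∏₂ agree y y ≡ 1ℚ
∏₂agree-refl []       = refl
∏₂agree-refl (y ∷ ys) = cong₂ (λ b z → (if b then 0ℚ else 1ℚ) * z) (xor-same y) (∏₂agree-refl ys)

-- Besides being a payoff, `∏₂ agree y` is the point mass at `y`; the two-point measure in
-- `nonconstant⇒k≤d` is built from it.
sum-point : ∀ (y : Cube n) g → sum (cube n) (λ x → ∏₂ agree y x * g x) ≡ g y
sum-point []              g = trans (+-identityʳ _) (*-identityˡ (g []))
sum-point {suc n} (b ∷ y) g = trans (sum-cube-∷ n (λ x → ∏₂ agree (b ∷ y) x * g x))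
  (trans (cong₂ _+_ (half false) (half true)) (select b))
  where
  half : ∀ c → sum (cube n) (λ x → agree b c * ∏₂ agree y x * g (c ∷ x)) ≡ agree b c * g (c ∷ y)
  half c = trans (sum-cong (cube n) (λ x → *-assoc (agree b c) (∏₂ agree y x) (g (c ∷ x))))
    (trans (sum-*ˡ (cube n) (agree b c) _) (cong (agree b c *_) (sum-point y (λ x → g (c ∷ x)))))
  select : ∀ b → agree b false * g (false ∷ y) + agree b true * g (true ∷ y) ≡ g (b ∷ y)
  select false = solve 2 (λ p q → con 1ℚ :* p :+ con 0ℚ :* q := p) refl (g (false ∷ y)) (g (true ∷ y))
  select true  = solve 2 (λ p q → con 0ℚ :* p :+ con 1ℚ :* q := q) refl (g (false ∷ y)) (g (true ∷ y))

payoff-agree : Payoff agree 1ℚ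
payoff-agree = record { 0≤λ′ = nonNegative⁻¹ 1ℚ ; correct = ∏₂agree-refl ; wrong = 0≤∏₂agree }

Nonconstant : (Cube n → Bool) → Set
Nonconstant f = ∃[ x₀ ] ∃[ x₁ ] f x₀ ≡ false × f x₁ ≡ true

nonconstant⇒k≤d : (f : Cube n → Bool) → Nonconstant f → Computable (f ^ᵏ k) d → k ℕ.≤ d
nonconstant⇒k≤d {n} {k} {d} f (x₀ , x₁ , f₀ , f₁) c with k ℕ.≤? d
... | yes k≤d = k≤d
... | no  k≰d = ⊥-elim (≤⇒≯ impossible
  (*-monoˡ-<-pos (2ℚ ^ d) {{positive (0<p^n d (positive⁻¹ 2ℚ))}} (positive⁻¹ (ℤ.+ 1 / 5))))
  where
  m : Cube n → ℚ
  m x = ∏₂ agree x₀ x + ∏₂ agree x₁ x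

  sum-m* : ∀ g → sum (cube n) (λ x → m x * g x) ≡ g x₀ + g x₁
  sum-m* g = trans (sum-cong (cube n) (λ x → *-distribʳ-+ (g x) (∏₂ agree x₀ x) (∏₂ agree x₁ x)))
    (trans (sum-+ (cube n) _ _) (cong₂ _+_ (sum-point x₀ g) (sum-point x₁ g)))

  sum-m : sum (cube n) m ≡ 2ℚ
  sum-m = trans (sum-cong (cube n) (λ x → sym (*-identityʳ (m x)))) (sum-m* (λ _ → 1ℚ))

  -- For either `v` exactly one of the two terms survives, and it is ±1. So `B` is 1 against a total
  -- mass of 2.
  half-bound : ∀ s₀ s₁ v → ∣ sign s₀ * agree false v + sign s₁ * agree true v ∣ ≤ 1ℚ
  half-bound false false false = ≤-refl
  half-bound false false true  = ≤-refl
  half-bound false true  false = ≤-refl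
  half-bound false true  true  = ≤-refl
  half-bound true  false false = ≤-refl
  half-bound true  false true  = ≤-refl
  half-bound true  true  false = ≤-refl
  half-bound true  true  true  = ≤-refl

  bound : ∀ v a → ∣ fourier (λ x → m x * agree (f x) v) a ∣ ≤ 1ℚ
  bound v a = subst (λ z → ∣ z ∣ ≤ 1ℚ) (sym (trans (sum-cong (cube n) (λ x →
      solve 3 (λ p q r → p :* (q :* r) := q :* (p :* r)) refl (χ a x) (m x) (agree (f x) v)))
      (trans (sum-m* (λ x → χ a x * agree (f x) v))
        (cong₂ (λ b₀ b₁ → χ a x₀ * agree b₀ v + χ a x₁ * agree b₁ v) f₀ f₁))))
    (half-bound ⟨ a , x₀ ⟩ ⟨ a , x₁ ⟩ v)

  core : (1ℚ - 1ℚ * (ℤ.+ 2 / 5)) * sum (cube n) m ^ k ≤ 2ℚ ^ d * 1ℚ ^ k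
  core = direct-sum f c (ℤ.+ 2 / 5) (rational-weights (f ^ᵏ k) c) payoff-agree m
    (λ x → 0≤p+q (0≤∏₂agree x₀ x) (0≤∏₂agree x₁ x)) (nonNegative⁻¹ 1ℚ) bound

  -- `core` reads 3/5 · 2ᵏ ≤ 2ᵈ. If d < k, then 2 · 2ᵈ ≤ 2ᵏ, hence 6/5 · 2ᵈ ≤ 2ᵈ.
  impossible : (ℤ.+ 1 / 5) * 2ℚ ^ d ≤ 0ℚ * 2ℚ ^ d
  impossible = subst₂ _≤_
    (solve 1 (λ X → con (ℤ.+ 3 / 5) :* (con 2ℚ :* X) :- X := con (ℤ.+ 1 / 5) :* X) refl (2ℚ ^ d))
    (solve 1 (λ X → X :- X := con 0ℚ :* X) refl (2ℚ ^ d))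
    (+-monoˡ-≤ (- (2ℚ ^ d)) (≤-trans
      (*-monoˡ-≤ {ℤ.+ 3 / 5} (nonNegative⁻¹ (ℤ.+ 3 / 5)) (2^-mono (ℕₚ.≰⇒> k≰d)))
      (subst₂ _≤_ (cong (λ s → (ℤ.+ 3 / 5) * s ^ k) sum-m)
        (trans (cong (2ℚ ^ d *_) (1^n≡1 k)) (*-identityʳ (2ℚ ^ d))) core)))

constant? : (f : Cube n → Bool) (b : Bool) → (∃[ x ] f x ≡ b) ⊎ (∀ x → f x ≡ not b)
constant? {zero} f b with f [] in eq
constant? {zero} f false | false = inj₁ ([] , eq)
constant? {zero} f false | true  = inj₂ λ { [] → eq }
constant? {zero} f true  | true  = inj₁ ([] , eq)
constant? {zero} f true  | false = inj₂ λ { [] → eq }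
constant? {suc n} f b with constant? (f ∘ (false ∷_)) b | constant? (f ∘ (true ∷_)) b
... | inj₁ (x , eq) | _             = inj₁ (false ∷ x , eq)
... | inj₂ _        | inj₁ (x , eq) = inj₁ (true ∷ x , eq)
... | inj₂ c₀       | inj₂ c₁       = inj₂ λ { (false ∷ x) → c₀ x ; (true ∷ x) → c₁ x }

-- Discrepancy

restrict : (Cube n → Bool) → (Cube n → ℚ) → ℚ
restrict S F = sum (cube _) (λ x → if S x then F x else 0ℚ)

-- A rational stand-in for `μ`, not normalised: biases are compared with `t` times the total mass.
-- The strict inequality forces that total to be positive.
record RationalMeasure (f : Cube n → Bool) (t : ℚ) : Set where
  field
    m     : Cube n → ℚ
    0≤m   : ∀ x → 0ℚ ≤ m x
    0≤t   : 0ℚ ≤ t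
    bias< : ∀ S → IsAffineSubspace S → ∣ restrict S (λ x → sign (f x) * m x) ∣ < t * sum (cube n) m

whole-affine : IsAffineSubspace {n} (λ _ → true)
whole-affine = 𝟎 , (λ _ → true) , (refl , λ _ _ _ _ → refl) , λ _ → refl

-- The slack in M <ʳ t absorbs the rounding errors of the masses and of their total.
disc-measure : ∀ (f : Cube n → Bool) (μ : Distribution n) {M} → IsMax IsAffineSubspace (bias f μ) M →
               M <ʳ fromℚ t → RationalMeasure f t
disc-measure {n} {t} f μ {M} isMax (i , M<t) = record
  { m     = value
  ; 0≤m   = 0≤value
  ; 0≤t   = 0≤t
  ; bias< = λ S affine → +-cancelʳ-< η (begin-strict
      ∣ restrict S F ∣ + η          ≤⟨ +-monoˡ-≤ η (restrict≤ S affine) ⟩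
      seq M i + (η + κ) + η         ≡⟨ solve 3 (λ M η κ → M :+ (η :+ κ) :+ η := M :+ (η :+ η) :+ κ) refl
                                         (seq M i) η κ ⟩
      seq M i + (η + η) + κ         <⟨ +-monoˡ-< κ M<t ⟩
      t + κ                         ≡⟨ cong (_+ κ) (sym (*-identityʳ t)) ⟩
      t * 1ℚ + κ                    ≤⟨ +-monoˡ-≤ κ (*-monoˡ-≤ 0≤t (mass≥ (proj₂ (Distribution.total μ)))) ⟩
      t * (s + κ) + κ               ≡⟨ solve 3 (λ t s κ → t :* (s :+ κ) :+ κ := t :* s :+ κ :* (con 1ℚ :+ t)) refl t s κ ⟩
      t * s + κ * (1ℚ + t)          ≤⟨ +-monoʳ-≤ (t * s) small ⟩
      t * s + η                     ∎)
  }
  where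
  open ≤-Reasoning
  open IsMax isMax
  -- The error `κ` enters once through the bias and `t` times through the total mass, hence the
  -- factor `1ℚ + t`.
  open Snapshot (snapshot (mass μ) (Distribution.nonNeg μ) (cube n) i (1ℚ + t))
  η s : ℚ
  η = ½ ^ i
  s = sum (cube n) value
  F : Cube n → ℚ
  F x = sign (f x) * value x

  0≤t : 0ℚ ≤ t
  -- Some bias has to be at hand to bound `M` from below; the whole cube provides one.
  0≤t = ≤-trans (0≤∣p∣ (seq (∑ (filterᵇ (λ _ → true) (cube n)) (λ x → if f x then -ʳ mass μ x else mass μ x)) i))
    (≤-trans (upper (λ _ → true) whole-affine i) (<⇒≤ M<t))

  signed≈ : ∀ x → (if f x then -ʳ mass μ x else mass μ x) ≈ F x ± radius
  signed≈ x with f x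
  ... | true  = subst (λ z → -ʳ mass μ x ≈ z ± radius)
    (solve 1 (λ v → :- v := con (- 1ℚ) :* v) refl (value x)) (≈-neg (w≈value x))
  ... | false = subst (λ z → mass μ x ≈ z ± radius) (sym (*-identityˡ (value x))) (w≈value x)

  restrict≤ : ∀ S → IsAffineSubspace S → ∣ restrict S F ∣ ≤ seq M i + (η + κ)
  restrict≤ S affine = subst (λ z → ∣ z ∣ ≤ seq M i + (η + κ)) (sum-filter (T? ∘ S) (cube n) F)
    (filtered-≤ (T? ∘ S) (upper S affine) (≈-abs (≈-∑ (filterᵇ S (cube n)) signed≈)) (≈-seq M i))

⊕-identityʳ : (x : Cube n) → x ⊕ 𝟎 ≡ x
⊕-identityʳ = zipWith-identityʳ xor-identityʳ

hyperplane : Cube n → Cube n → Bool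
hyperplane a x = not ⟨ a , x ⟩

hyperplane-affine : (a : Cube n) → IsAffineSubspace (hyperplane a)
hyperplane-affine a = 𝟎 , hyperplane a , (cong not (⟨⟩-zeroʳ a) , closed) ,
  λ x → cong (hyperplane a) (sym (⊕-identityʳ x))
  where
  closed : ∀ x y → hyperplane a x ≡ true → hyperplane a y ≡ true → hyperplane a (x ⊕ y) ≡ true
  closed x y hx hy rewrite ⟨⟩-⊕ʳ a x y with ⟨ a , x ⟩ | ⟨ a , y ⟩
  ... | false | false = refl

-- The other coset of the hyperplane is avoided: for a = 0 it is empty, hence not affine.
fourier-restrict : ∀ (F : Cube n → ℚ) a → fourier F a ≡ 2ℚ * restrict (hyperplane a) F - restrict (λ _ → true) F
fourier-restrict {n} F a = begin
  fourier F a ≡⟨ sum-cong (cube n) pointwise ⟩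
  sum (cube n) (λ x → 2ℚ * (if hyperplane a x then F x else 0ℚ) + - F x)
    ≡⟨ trans (sum-+ (cube n) _ _) (cong₂ _+_ (sum-*ˡ (cube n) 2ℚ _) (sum-neg (cube n) F)) ⟩
  2ℚ * restrict (hyperplane a) F - restrict (λ _ → true) F ∎
  where
  open ≡-Reasoning
  pointwise : ∀ x → χ a x * F x ≡ 2ℚ * (if hyperplane a x then F x else 0ℚ) + - F x
  pointwise x with ⟨ a , x ⟩
  ... | false = solve 1 (λ p → con 1ℚ :* p := con 2ℚ :* p :+ :- p) refl (F x)
  ... | true  = solve 1 (λ p → con (- 1ℚ) :* p := con 2ℚ :* con 0ℚ :+ :- p) refl (F x)

module _ {f : Cube n → Bool} (measure : RationalMeasure f t) where
  open RationalMeasure measure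

  private
    s : ℚ
    s = sum (cube n) m
    F : Cube n → ℚ
    F x = sign (f x) * m x

  -- Of the factor 3, the hyperplane contributes 2 and the whole cube 1.
  fourier-disc : ∀ a → ∣ fourier F a ∣ ≤ ι 3 * (t * s)
  fourier-disc a = begin
    ∣ fourier F a ∣ ≡⟨ cong ∣_∣ (fourier-restrict F a) ⟩
    ∣ 2ℚ * H - R ∣  ≤⟨ ∣p-q∣≤∣p∣+∣q∣ (2ℚ * H) R ⟩
    ∣ 2ℚ * H ∣ + ∣ R ∣ ≡⟨ cong (_+ ∣ R ∣) (∣p*q∣≡∣p∣*∣q∣ 2ℚ H) ⟩
    2ℚ * ∣ H ∣ + ∣ R ∣
      ≤⟨ +-mono-≤ (*-monoˡ-≤ {2ℚ} (nonNegative⁻¹ 2ℚ) (<⇒≤ (bias< (hyperplane a) (hyperplane-affine a))))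
           (<⇒≤ (bias< (λ _ → true) whole-affine)) ⟩
    2ℚ * (t * s) + t * s ≡⟨ solve 1 (λ p → con 2ℚ :* p :+ p := con (ι 3) :* p) refl (t * s) ⟩
    ι 3 * (t * s) ∎
    where
    open ≤-Reasoning
    H R : ℚ
    H = restrict (hyperplane a) F
    R = restrict (λ _ → true) F

  0<s : 0ℚ < s
  0<s with 0ℚ <? s
  ... | yes 0<s = 0<s
  ... | no  0≮s = ⊥-elim (≤⇒≯ (subst (t * s ≤_) (*-zeroʳ t) (*-monoˡ-≤ 0≤t (≮⇒≥ 0≮s)))
    (≤-<-trans (0≤∣p∣ (restrict (λ _ → true) F)) (bias< (λ _ → true) whole-affine)))

  -- A constant function has no cancellation, so its bias on the whole cube is the total mass.
  constant⇒1<t : ∀ b → (∀ x → f x ≡ b) → 1ℚ < t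
  constant⇒1<t b eq = *-cancelʳ-<-nonNeg s {{nonNegative (<⇒≤ 0<s)}} (subst (_< t * s)
    (begin
      ∣ restrict (λ _ → true) F ∣
        ≡⟨ cong ∣_∣ (trans (sum-cong (cube n) (λ x → cong (λ c → sign c * m x) (eq x))) (sum-*ˡ (cube n) (sign b) m)) ⟩
      ∣ sign b * s ∣                   ≡⟨ ∣p*q∣≡∣p∣*∣q∣ (sign b) s ⟩
      ∣ sign b ∣ * ∣ s ∣               ≡⟨ cong₂ _*_ (∣sign∣ b) (0≤p⇒∣p∣≡p (<⇒≤ 0<s)) ⟩
      1ℚ * s                           ∎)
    (bias< (λ _ → true) whole-affine))
    where
    open ≡-Reasoning
    ∣sign∣ : ∀ b → ∣ sign b ∣ ≡ 1ℚ
    ∣sign∣ false = refl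
    ∣sign∣ true  = refl

-- The witness is the parity of the number of wrong bits. The payoff is therefore ±1, and an error
-- costs at most 2.
∏₂sign : (y v : Vec Bool k) → ∃[ b ] ∏₂ (λ b c → sign (b xor c)) y v ≡ sign b
∏₂sign []       []       = false , refl
∏₂sign (y ∷ ys) (v ∷ vs) with ∏₂sign ys vs
... | b , eq = (y xor v) xor b , trans (cong (sign (y xor v) *_) eq) (sym (sign-xor (y xor v) b))

payoff-sign : Payoff (λ b c → sign (b xor c)) 2ℚ
payoff-sign = record
  { 0≤λ′    = nonNegative⁻¹ 2ℚ
  ; correct = correct
  ; wrong   = λ y v → subst (1ℚ - 2ℚ ≤_) (sym (proj₂ (∏₂sign y v))) (-1≤sign (proj₁ (∏₂sign y v)))
  }
  where
  correct : (y : Vec Bool k) → ∏₂ (λ b c → sign (b xor c)) y y ≡ 1ℚ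
  correct []       = refl
  correct (y ∷ ys) = cong₂ (λ b z → sign b * z) (xor-same y) (correct ys)
  -1≤sign : ∀ b → 1ℚ - 2ℚ ≤ sign b
  -1≤sign false = ≤ᵇ⇒≤ _
  -1≤sign true  = ≤-refl

disc⇒error : ∀ (f : Cube n → Bool) → RationalMeasure f t → Computable (f ^ᵏ k) d →
             ℤ.+ 1 / 5 ≤ 2ℚ ^ d * (ι 3 * t) ^ k
disc⇒error {n} {t} {k} {d} f measure c = *-cancelˡ-≤ (0<p^n k (0<s measure)) (subst₂ _≤_
    (*-comm (ℤ.+ 1 / 5) (s ^ k))
    (trans (cong (2ℚ ^ d *_) (trans (cong (_^ k) (sym (*-assoc (ι 3) t s))) (^-distribʳ-* (ι 3 * t) s k)))
      (solve 3 (λ a b c → a :* (b :* c) := c :* (a :* b)) refl (2ℚ ^ d) ((ι 3 * t) ^ k) (s ^ k)))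
    core)
  where
  open RationalMeasure measure
  s : ℚ
  s = sum (cube n) m
  -- A fixed output bit `v` only multiplies the coefficient by a global sign.
  bound : ∀ v a → ∣ fourier (λ x → m x * sign (f x xor v)) a ∣ ≤ ι 3 * (t * s)
  bound v a = subst (_≤ ι 3 * (t * s)) (sym (begin
    ∣ fourier (λ x → m x * sign (f x xor v)) a ∣
      ≡⟨ cong ∣_∣ (trans (sum-cong (cube n) (λ x → trans (cong (λ z → χ a x * (m x * z)) (sign-xor (f x) v))
          (solve 4 (λ p q r u → p :* (q :* (r :* u)) := u :* (p :* (r :* q))) refl
             (χ a x) (m x) (sign (f x)) (sign v))))
          (sum-*ˡ (cube n) (sign v) _)) ⟩
    ∣ sign v * fourier (λ x → sign (f x) * m x) a ∣ ≡⟨ ∣sign*∣ v _ ⟩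
    ∣ fourier (λ x → sign (f x) * m x) a ∣ ∎)) (fourier-disc measure a)
    where
    open ≡-Reasoning
    ∣sign*∣ : ∀ v p → ∣ sign v * p ∣ ≡ ∣ p ∣
    ∣sign*∣ false p = cong ∣_∣ (*-identityˡ p)
    ∣sign*∣ true  p = trans (cong ∣_∣ (solve 1 (λ p → con (- 1ℚ) :* p := :- p) refl p)) (∣-p∣≡∣p∣ p)
  -- The advantage 1 - 2 · 2/5 = 1/5 is positive because the error is below 1/2.
  core : (1ℚ - 2ℚ * (ℤ.+ 2 / 5)) * s ^ k ≤ 2ℚ ^ d * (ι 3 * (t * s)) ^ k
  core = direct-sum f c (ℤ.+ 2 / 5) (rational-weights (f ^ᵏ k) c) payoff-sign m 0≤m
    (0≤p*q {ι 3} (nonNegative⁻¹ (ι 3)) (0≤p*q 0≤t (<⇒≤ (0<s measure)))) bound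

-- Comparison of exponents and the final bound

exponent-bound : ∀ u v → 0ℚ ≤ t → t ^ v ≤ ½ ^ u → ℤ.+ 1 / 5 ≤ 2ℚ ^ d * (ι 3 * t) ^ k →
                 k ℕ.* u ℕ.≤ v ℕ.* ((3 ℕ.+ d) ℕ.+ k ℕ.* 2)
exponent-bound {t} {d} {k} u v 0≤t t^v≤ 1/5≤ = 2^-cancel-≤ (k ℕ.* u) (v ℕ.* E) (begin
  2ℚ ^ (k ℕ.* u)                                 ≡⟨ sym (*-identityˡ (2ℚ ^ (k ℕ.* u))) ⟩
  1ℚ * 2ℚ ^ (k ℕ.* u)                            ≤⟨ *-monoʳ-≤ (0≤2^ (k ℕ.* u)) raised ⟩
  2ℚ ^ (v ℕ.* E) * (½ ^ u) ^ k * 2ℚ ^ (k ℕ.* u)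
    ≡⟨ trans (*-assoc (2ℚ ^ (v ℕ.* E)) ((½ ^ u) ^ k) (2ℚ ^ (k ℕ.* u))) (cong (2ℚ ^ (v ℕ.* E) *_) cancel) ⟩
  2ℚ ^ (v ℕ.* E) * 1ℚ                            ≡⟨ *-identityʳ (2ℚ ^ (v ℕ.* E)) ⟩
  2ℚ ^ (v ℕ.* E)                                 ∎)
  where
  open ≤-Reasoning
  -- The constants are rounded up to powers of two: 5 ≤ 2³ gives the 3, and 3ᵏ ≤ 2²ᵏ gives
  -- `k ℕ.* 2`.
  E : ℕ
  E = (3 ℕ.+ d) ℕ.+ k ℕ.* 2
  0≤2^ : ∀ i → 0ℚ ≤ 2ℚ ^ i
  0≤2^ i = 0≤p^n i (nonNegative⁻¹ 2ℚ)

  cancel : (½ ^ u) ^ k * 2ℚ ^ (k ℕ.* u) ≡ 1ℚ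
  cancel = trans (cong (_* 2ℚ ^ (k ℕ.* u)) (^-*-assoc ½ u k)) (½^*2^ (k ℕ.* u))

  base : 1ℚ ≤ 2ℚ ^ E * t ^ k
  base = begin
    ι 5 * (ℤ.+ 1 / 5)                  ≤⟨ *-monoˡ-≤ {ι 5} (nonNegative⁻¹ (ι 5)) 1/5≤ ⟩
    ι 5 * (2ℚ ^ d * (ι 3 * t) ^ k)     ≤⟨ *-mono-≤ {ι 5} {2ℚ ^ 3}
      (0≤p*q (0≤2^ d) (0≤p^n k (0≤p*q {ι 3} (nonNegative⁻¹ (ι 3)) 0≤t))) (nonNegative⁻¹ (2ℚ ^ 3)) (≤ᵇ⇒≤ _)
      (*-monoˡ-≤ (0≤2^ d) (^-monoˡ-≤ k (0≤p*q {ι 3} (nonNegative⁻¹ (ι 3)) 0≤t)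
        (*-monoʳ-≤ {t} {ι 3} {2ℚ ^ 2} 0≤t (≤ᵇ⇒≤ _)))) ⟩
    2ℚ ^ 3 * (2ℚ ^ d * (2ℚ ^ 2 * t) ^ k)
      ≡⟨ cong (λ z → 2ℚ ^ 3 * (2ℚ ^ d * z)) (trans (^-distribʳ-* (2ℚ ^ 2) t k) (cong (_* t ^ k) (^-*-assoc 2ℚ 2 k))) ⟩
    2ℚ ^ 3 * (2ℚ ^ d * (2ℚ ^ (k ℕ.* 2) * t ^ k))
      ≡⟨ solve 4 (λ a b c e → a :* (b :* (c :* e)) := a :* b :* c :* e) refl (2ℚ ^ 3) (2ℚ ^ d) (2ℚ ^ (k ℕ.* 2)) (t ^ k) ⟩
    2ℚ ^ 3 * 2ℚ ^ d * 2ℚ ^ (k ℕ.* 2) * t ^ k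
      ≡⟨ cong (_* t ^ k) (sym (trans (^-distribˡ-+-* 2ℚ (3 ℕ.+ d) (k ℕ.* 2))
           (cong (_* 2ℚ ^ (k ℕ.* 2)) (^-distribˡ-+-* 2ℚ 3 d)))) ⟩
    2ℚ ^ E * t ^ k                     ∎

  -- Only `t ^ v` is compared with a power of two, so `base` is raised to the power `v` before `t`
  -- is eliminated.
  raised : 1ℚ ≤ 2ℚ ^ (v ℕ.* E) * (½ ^ u) ^ k
  raised = begin
    1ℚ                               ≤⟨ 1≤p^n v base ⟩
    (2ℚ ^ E * t ^ k) ^ v             ≡⟨ ^-distribʳ-* (2ℚ ^ E) (t ^ k) v ⟩
    (2ℚ ^ E) ^ v * (t ^ k) ^ v       ≡⟨ cong₂ _*_ (^-*-assoc 2ℚ E v)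
      (trans (^-*-assoc t k v) (trans (cong (t ^_) (ℕₚ.*-comm v k)) (sym (^-*-assoc t v k)))) ⟩
    2ℚ ^ (v ℕ.* E) * (t ^ v) ^ k     ≤⟨ *-monoˡ-≤ (0≤2^ (v ℕ.* E)) (^-monoˡ-≤ k (0≤p^n v 0≤t) t^v≤) ⟩
    2ℚ ^ (v ℕ.* E) * (½ ^ u) ^ k     ∎

mkℚ-*-↧ : ∀ u v .(c : Coprime u (suc v)) → mkℚ (ℤ.+ u) v c * ι (suc v) ≡ ι u
mkℚ-*-↧ u v c = toℚᵘ-injective (begin
  toℚᵘ (mkℚ (ℤ.+ u) v c * ι (suc v))             ≈⟨ toℚᵘ-homo-* (mkℚ (ℤ.+ u) v c) (ι (suc v)) ⟩
  ℚᵘ.mkℚᵘ (ℤ.+ u) v ℚᵘ.* toℚᵘ (ι (suc v))         ≈⟨ ℚᵘₚ.*-congˡ {ℚᵘ.mkℚᵘ (ℤ.+ u) v} (toℚᵘ-ι (suc v)) ⟩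
  ℚᵘ.mkℚᵘ (ℤ.+ u) v ℚᵘ.* ℚᵘ.mkℚᵘ (ℤ.+ suc v) 0    ≈⟨ ℚᵘ.*≡* (trans (ℤₚ.*-identityʳ (ℤ.+ u ℤ.* ℤ.+ suc v))
                                                    (cong (λ z → ℤ.+ u ℤ.* ℤ.+ z) (sym (ℕₚ.*-identityʳ (suc v))))) ⟩
  ℚᵘ.mkℚᵘ (ℤ.+ u) 0                              ≈⟨ ℚᵘₚ.≃-sym (toℚᵘ-ι u) ⟩
  toℚᵘ (ι u)                                    ∎)
  where open SetoidReasoning ℚᵘₚ.≃-setoid

-- From 1 ≤ k ≤ d, the exponent 3 + d + 2k is at most 3d + d + 2d = 6d. The constant is 1/7 rather
-- than 1/6 because `𝖱` asks for a strict inequality; `d` is positive, so 6/7 · d < d.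
rational-bound : ∀ u v .(c : Coprime u (suc v)) → 0 ℕ.< k → k ℕ.≤ d →
                 k ℕ.* u ℕ.≤ suc v ℕ.* ((3 ℕ.+ d) ℕ.+ k ℕ.* 2) →
                 (ℤ.+ 1 / 7 * ι k) * mkℚ (ℤ.+ u) v c < ι d
rational-bound {k} {d} u v c 0<k k≤d le = begin-strict
  (ℤ.+ 1 / 7 * ι k) * P     ≡⟨ *-assoc (ℤ.+ 1 / 7) (ι k) P ⟩
  ℤ.+ 1 / 7 * (ι k * P)     ≤⟨ *-monoˡ-≤ {ℤ.+ 1 / 7} (nonNegative⁻¹ (ℤ.+ 1 / 7)) kP≤ ⟩
  ℤ.+ 1 / 7 * (ι 6 * ι d)   ≡⟨ sym (*-assoc (ℤ.+ 1 / 7) (ι 6) (ι d)) ⟩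
  (ℤ.+ 1 / 7 * ι 6) * ι d   <⟨ *-monoˡ-<-pos (ι d) {{positive (0<ι (ℕₚ.<-≤-trans 0<k k≤d))}} 6/7<1 ⟩
  1ℚ * ι d                  ≡⟨ *-identityˡ (ι d) ⟩
  ι d                       ∎
  where
  open ≤-Reasoning
  P : ℚ
  P = mkℚ (ℤ.+ u) v c
  6/7<1 : ℤ.+ 1 / 7 * ι 6 < 1ℚ
  6/7<1 = *<* (ℤ.+<+ (ℕₚ.≤-refl {7}))
  E≤6d : (3 ℕ.+ d) ℕ.+ k ℕ.* 2 ℕ.≤ 6 ℕ.* d
  E≤6d = ℕₚ.≤-trans
    (ℕₚ.+-mono-≤ (ℕₚ.+-monoˡ-≤ d (ℕₚ.*-monoʳ-≤ 3 (ℕₚ.≤-trans 0<k k≤d))) (ℕₚ.*-monoˡ-≤ 2 k≤d))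
    (ℕₚ.≤-reflexive (6d d))
    where
    6d : ∀ d → (3 ℕ.* d ℕ.+ d) ℕ.+ d ℕ.* 2 ≡ 6 ℕ.* d
    6d = solve-∀
  kP≤ : ι k * P ≤ ι 6 * ι d
  kP≤ = *-cancelˡ-≤ (0<ι {suc v} (ℕ.s≤s ℕ.z≤n)) (begin
    ι (suc v) * (ι k * P)          ≡⟨ solve 3 (λ a b c → a :* (b :* c) := b :* (c :* a)) refl (ι (suc v)) (ι k) P ⟩
    ι k * (P * ι (suc v))          ≡⟨ trans (cong (ι k *_) (mkℚ-*-↧ u v c)) (sym (ι-* k u)) ⟩
    ι (k ℕ.* u)                    ≤⟨ ι-mono (ℕₚ.≤-trans le (ℕₚ.*-monoʳ-≤ (suc v) E≤6d)) ⟩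
    ι (suc v ℕ.* (6 ℕ.* d))        ≡⟨ trans (ι-* (suc v) (6 ℕ.* d)) (cong (ι (suc v) *_) (ι-* 6 d)) ⟩
    ι (suc v) * (ι 6 * ι d)        ∎)

-- The hypothesis keeps `t ^ suc v` at most 1, whereas a constant `f` would force 1 < t.
nonconstant : ∀ (f : Cube n → Bool) → RationalMeasure f t → ∀ u v → t ^ suc v ≤ ½ ^ u → Nonconstant f
nonconstant {n} {t} f measure u v t^v≤ = go (constant? f false) (constant? f true)
  where
  ½^≤1 : ∀ u → ½ ^ u ≤ 1ℚ
  ½^≤1 u = subst (½ ^ u ≤_) (1^n≡1 u) (^-monoˡ-≤ u (nonNegative⁻¹ ½) (≤ᵇ⇒≤ _))
  absurd : ∀ b → (∀ x → f x ≡ b) → ⊥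
  absurd b eq = ≤⇒≯ (≤-trans t^v≤ (½^≤1 u)) (<-≤-trans 1<t
    (subst (_≤ t * t ^ v) (*-identityʳ t) (*-monoˡ-≤ (RationalMeasure.0≤t measure) (1≤p^n v (<⇒≤ 1<t)))))
    where 1<t = constant⇒1<t measure b eq
  go : _ → _ → Nonconstant f
  go (inj₁ (x₀ , eq₀)) (inj₁ (x₁ , eq₁)) = x₀ , x₁ , eq₀ , eq₁
  go (inj₂ eq) _         = ⊥-elim (absurd true eq)
  go (inj₁ _) (inj₂ eq)  = ⊥-elim (absurd false eq)

lower-bound : ∀ (f : Cube n → Bool) p → 0 ℕ.< k → disc f p → Computable (f ^ᵏ k) d →
              (ℤ.+ 1 / 7 * ι k) * p < ι d
-- For negative `p` the left side is negative while `d` is not; constant functions can occur only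
-- here.
lower-bound {k = k} {d = d} f p@(mkℚ ℤ.-[1+ _ ] _ _) 0<k _ _ = <-≤-trans
  (subst ((ℤ.+ 1 / 7 * ι k) * p <_) (*-zeroʳ (ℤ.+ 1 / 7 * ι k))
    (*-monoʳ-<-pos (ℤ.+ 1 / 7 * ι k)
      {{positive (0<p*q {ℤ.+ 1 / 7} (positive⁻¹ (ℤ.+ 1 / 7)) (0<ι 0<k))}} (negative⁻¹ p)))
  (0≤ι d)
lower-bound {k = k} {d = d} f (mkℚ (ℤ.+ u) v c) 0<k (μ , M , isMax , t , M<t , t^v≤2^-u) computable =
  rational-bound u v c 0<k (nonconstant⇒k≤d f (nonconstant f measure u v t^v≤) computable)
    (exponent-bound {d = d} {k = k} u (suc v) (RationalMeasure.0≤t measure) t^v≤ (disc⇒error f measure computable))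
  where
  measure : RationalMeasure f t
  measure = disc-measure f μ isMax M<t
  t^v≤ : t ^ suc v ≤ ½ ^ u
  t^v≤ = subst (t ^ suc v ≤_) (2^-neg u) t^v≤2^-u

open import Data.Integer using (+_)

theorem1 : ∃[ c ] 0ℚ < c × (∀ (n k : ℕ) .{{_ : NonZero n}} .{{_ : NonZero k}} (f : Cube n → Bool) → (c * (+ k / 1)) · disc f ≤ᴸ 𝖱 (f ^ᵏ k))
theorem1 = + 1 / 7 , positive⁻¹ (+ 1 / 7) ,
  λ n k f q (p , disc-p , q≤) d computable → ≤-<-trans q≤ (lower-bound f p (ℕ.>-nonZero⁻¹ k) disc-p computable)
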